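{- Let $H=(E,\{X_i : i\in[n]\})$ be a hypergraph and let $t_1,\dots,t_n$ be integers with $0\le t_i\le |X_i|$, such that: (H2) $|X_i\cap X_j|\le 1$ for all distinct $i,j\in[n]$; (H3) there are no $a,b,c\in E$ such that $\{a,b\},\{a,c\},\{b,c\}$ are all hyperedges of $H$; (T) for each $i\in[n]$, either $t_i=1$ or $\min\{w(e) : e\in X_i\}\le t_i<|X_i|$. Let $\rho$ be the polymatroid on $E$ given by $\rho(A)=\sum_{i=1}^n\min\{|A\cap X_i|,t_i\}$ for $A\subseteq E$ (equivalently $\rho=\sum_{i=1}^n r_{M_i}$ with $M_i=U_{t_i,X_i}\oplus U_{0,E-X_i}$). Then for each positive integer $k$ there is a bijection from the set of proper $k$-colorings $c:[n]\to[k]$ of the line graph $G_H$ onto $\Delta_\rho^k$. Consequently, the least $k$ with $\rho\in\mathcal{D}_k$ is $k=\chi(G_H)$, and $|\Delta_\rho^k|=\chi(G_H;k)$ for every positive integer $k$.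
   Context: A polymatroid on a finite set $E$ is a function $\rho:2^E\to\mathbb{Z}$ that is normalized ($\rho(\emptyset)=0$), non-decreasing, and submodular. A hypergraph is a pair $H=(E,\mathcal{E})$ where $E$ is a finite set and $\mathcal{E}=\{X_i:i\in[n]\}$ is a set of nonempty subsets of $E$ (the hyperedges), $[n]=\{1,\dots,n\}$. For $e\in E$, $w(e)$ is the number of hyperedges containing $e$. The line graph $G_H$ has vertex set $[n]$, with $ij$ an edge iff $i\ne j$ and $X_i\cap X_j\ne\emptyset$. $U_{r,X}$ is the rank-$r$ uniform matroid on $X$ (bases are the $r$-subsets of $X$). For a polymatroid $\rho$ on $E$ and positive integer $k$, $\Delta_\rho^k$ is the set of $k$-tuples $(N_1,\dots,N_k)$ of matroids on $E$ with $\rho=r_{N_1}+\cdots+r_{N_k}$ (pointwise sum of rank functions). $\mathcal{D}_k$ is the class of polymatroids $\rho$ for which $\Delta_\rho^k\neq\emptyset$ ($k$-decomposable polymatroids). $\chi(G_H)$ and $\chi(G_H;k)$ are the chromatic number and chromatic polynomial of $G_H$. -}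

module Defs where

open import Algebra.Properties.CommutativeMonoid.Sum using (sum; ∑-distrib-+)
open import Data.Fin.Base using (Fin; zero; suc; finToFun; funToFin)
import Data.Fin.Properties as Fin
open import Data.Fin.Subset
  using (Subset; inside; outside; _⊆_; _∩_; _∪_; ∣_∣; Nonempty; ⁅_⁆)
  renaming (⊥ to ∅)
open import Data.Fin.Subset.Properties
  using ( _∈?_; nonempty?; p⊆q⇒∣p∣≤∣q∣; p∩q⊆p; p∩q⊆q; x∈p∩q⁺; x∈p∩q⁻; ∩-comm
        ; ∩-distribʳ-∪; ∩-assoc; ∩-idem; ∣p∩q∣≤∣p∣; ∣⊥∣≡0 )
open import Data.Integer.Base as ℤ using (ℤ; 0ℤ; +_; +≤+)
open import Data.List.Base using (length; filter; map; allFin)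
open import Data.List.Extrema.Nat using (min)
open import Data.Nat.Base using (ℕ; zero; suc; _+_; _^_; _≤_; _⊓_; z≤n; s≤s)
import Data.Nat.Properties as ℕ
open import Data.Product.Base using (Σ; ∃; _×_; _,_; proj₁; proj₂)
open import Data.Sum.Base using (inj₁; inj₂)
open import Data.Vec.Base using ([]; _∷_)
open import Function.Base using (_∘_; id)
open import Function.Bundles using (Bijection)
open import Function.Definitions using (Injective)
open import Level using (0ℓ)
open import Relation.Binary.Bundles using (Setoid)
open import Relation.Binary.Definitions using (Symmetric; Irreflexive)
  renaming (Decidable to Decidable₂)
open import Relation.Binary.PropositionalEquality
  using (_≡_; _≢_; refl; sym; trans; cong; cong₂; subst; subst₂; setoid)
open import Relation.Nullary.Decidable using (yes; no; ¬?; _×-dec_; _→-dec_; map′)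
open import Relation.Nullary.Negation using (¬_; contradiction)
open import Relation.Unary using (Pred; Decidable)

IsLeast : Pred ℕ 0ℓ → ℕ → Set
IsLeast P k = P k × (∀ j → P j → k ≤ j)

least : {P : Pred ℕ 0ℓ} → Decidable P → ∀ n → P n → ∃ (IsLeast P)
least P? zero    p = zero , p , λ _ _ → z≤n
least {P} P? (suc n) p with P? zero
... | yes p₀ = zero , p₀ , λ _ _ → z≤n
... | no ¬p₀ with k , pk , k≤ ← least (P? ∘ suc) n p = suc k , pk , suc-k≤
  where
  suc-k≤ : ∀ j → P j → suc k ≤ j
  suc-k≤ zero    pj = contradiction pj ¬p₀
  suc-k≤ (suc j) pj = s≤s (k≤ j pj)

HasCardinality : Setoid 0ℓ 0ℓ → ℕ → Set
HasCardinality S N = Bijection (setoid (Fin N)) S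

Σ[_] : ∀ {n} → (Fin n → ℕ) → ℕ
Σ[_] = sum ℕ.+-0-commutativeMonoid

Σ-mono-≤ : ∀ {n} {f g : Fin n → ℕ} → (∀ i → f i ≤ g i) → Σ[ f ] ≤ Σ[ g ]
Σ-mono-≤ {zero}  f≤g = z≤n
Σ-mono-≤ {suc n} f≤g = ℕ.+-mono-≤ (f≤g zero) (Σ-mono-≤ (f≤g ∘ suc))

Σ-distrib-+ : ∀ {n} (f g : Fin n → ℕ) → Σ[ (λ i → f i + g i) ] ≡ Σ[ f ] + Σ[ g ]
Σ-distrib-+ = ∑-distrib-+ ℕ.+-0-commutativeMonoid

Σ-zero : ∀ {n} {f : Fin n → ℕ} → (∀ i → f i ≡ 0) → Σ[ f ] ≡ 0
Σ-zero {zero}  f≡0 = refl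
Σ-zero {suc n} f≡0 = cong₂ _+_ (f≡0 zero) (Σ-zero (f≡0 ∘ suc))

record Polymatroid (m : ℕ) : Set where
  field
    rank       : Subset m → ℤ
    normalized : rank ∅ ≡ 0ℤ
    monotone   : ∀ {A B} → A ⊆ B → rank A ℤ.≤ rank B
    submodular : ∀ A B → rank (A ∪ B) ℤ.+ rank (A ∩ B) ℤ.≤ rank A ℤ.+ rank B

-- Matroids are given by their rank functions, so two matroids are
-- equal when their ranks agree on every subset.
record Matroid (m : ℕ) : Set where
  field
    rank       : Subset m → ℕ
    bounded    : ∀ A → rank A ≤ ∣ A ∣
    monotone   : ∀ {A B} → A ⊆ B → rank A ≤ rank B
    submodular : ∀ A B → rank (A ∪ B) + rank (A ∩ B) ≤ rank A + rank B

  normalized : rank ∅ ≡ 0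
  normalized = ℕ.n≤0⇒n≡0 (subst (rank ∅ ≤_) (∣⊥∣≡0 m) (bounded ∅))

-- The set Δ_ρ^k.  For k = 0 the sum is empty, so this is inhabited only
-- when ρ is the zero polymatroid.
Δ : ∀ {m} → Polymatroid m → ℕ → Setoid 0ℓ 0ℓ
Δ {m} ρ k = record
  { Carrier = Σ (Fin k → Matroid m) λ N →
                ∀ A → Polymatroid.rank ρ A ≡ + Σ[ (λ j → Matroid.rank (N j) A) ]
  ; _≈_ = λ (N , _) (N′ , _) → ∀ j A → Matroid.rank (N j) A ≡ Matroid.rank (N′ j) A
  ; isEquivalence = record
    { refl  = λ _ _ → refl
    ; sym   = λ p j A → sym (p j A)
    ; trans = λ p q j A → trans (p j A) (q j A)
    }
  }

𝒟 : ∀ {m} → ℕ → Polymatroid m → Set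
𝒟 k ρ = Setoid.Carrier (Δ ρ k)

record Graph (n : ℕ) : Set₁ where
  field
    Adj    : Fin n → Fin n → Set
    symm   : Symmetric Adj
    irrefl : Irreflexive _≡_ Adj
    adj?   : Decidable₂ Adj

module _ {n : ℕ} (G : Graph n) where
  open Graph G

  Proper : ∀ {k} → (Fin n → Fin k) → Set
  Proper c = ∀ i j → Adj i j → c i ≢ c j

  proper? : ∀ {k} → Decidable (Proper {k})
  proper? c = Fin.all? λ i → Fin.all? λ j → adj? i j →-dec ¬? (c i Fin.≟ c j)

  ProperColorings : ℕ → Setoid 0ℓ 0ℓ
  ProperColorings k = record
    { Carrier = Σ (Fin n → Fin k) Proper
    ; _≈_ = λ (c , _) (c′ , _) → ∀ i → c i ≡ c′ i
    ; isEquivalence = record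
      { refl  = λ _ → refl
      ; sym   = λ p i → sym (p i)
      ; trans = λ p q i → trans (p i) (q i)
      }
    }

  Colorable : ℕ → Set
  Colorable k = Setoid.Carrier (ProperColorings k)

  colorable? : Decidable Colorable
  colorable? k = map′ (λ (x , p) → finToFun x , p) encode
                      (Fin.any? {n = k ^ n} (proper? ∘ finToFun))
    where
    encode : Colorable k → ∃ λ (x : Fin (k ^ n)) → Proper (finToFun x)
    encode (c , p) = funToFin c , λ i j a eq →
      p i j a (trans (sym (Fin.finToFun-funToFin c i))
                     (trans eq (Fin.finToFun-funToFin c j)))

  leastColorable : ∃ (IsLeast Colorable)
  leastColorable = least colorable? n (id , λ _ _ a i≡j → irrefl i≡j a)

  chromaticNumber : ℕ
  chromaticNumber = proj₁ leastColorable

  -- The value at k of the chromatic polynomial, that is, the number of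
  -- proper k-colorings; finToFun enumerates all maps Fin n → Fin k.
  chromaticPolynomial : ℕ → ℕ
  chromaticPolynomial k =
    length (filter (λ x → proper? {k} (finToFun x)) (allFin (k ^ n)))

-- Injectivity of X says that the hyperedges form a set: they are
-- listed without repetition.
record Hypergraph (m n : ℕ) : Set where
  field
    X           : Fin n → Subset m
    X-nonempty  : ∀ i → Nonempty (X i)
    X-injective : Injective _≡_ _≡_ X

  IsHyperedge : Subset m → Set
  IsHyperedge A = ∃ λ i → X i ≡ A

  w : Fin m → ℕ
  w e = length (filter (λ i → e ∈? X i) (allFin n))

  -- min { w e ∣ e ∈ X i }.  The first argument of min is the value used
  -- for an empty list; here it is w at an element of X i, so it does
  -- not affect the minimum.
  min-w : Fin n → ℕ
  min-w i = min (w (proj₁ (X-nonempty i))) (map w (filter (_∈? X i) (allFin m)))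

  lineGraph : Graph n
  lineGraph = record
    { Adj    = λ i j → i ≢ j × Nonempty (X i ∩ X j)
    ; symm   = λ {i} {j} (i≢j , ne) →
                 i≢j ∘ sym , subst Nonempty (∩-comm (X i) (X j)) ne
    ; irrefl = λ i≡j (i≢j , _) → i≢j i≡j
    ; adj?   = λ i j → ¬? (i Fin.≟ j) ×-dec nonempty? (X i ∩ X j)
    }

  NoTriangle : Set
  NoTriangle = ∀ a b c → a ≢ b → a ≢ c → b ≢ c →
    ¬ (IsHyperedge (⁅ a ⁆ ∪ ⁅ b ⁆) × IsHyperedge (⁅ a ⁆ ∪ ⁅ c ⁆) × IsHyperedge (⁅ b ⁆ ∪ ⁅ c ⁆))

∣∪∣+∣∩∣ : ∀ {m} (A B : Subset m) → ∣ A ∪ B ∣ + ∣ A ∩ B ∣ ≡ ∣ A ∣ + ∣ B ∣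
∣∪∣+∣∩∣ []            []            = refl
∣∪∣+∣∩∣ (outside ∷ A) (outside ∷ B) = ∣∪∣+∣∩∣ A B
∣∪∣+∣∩∣ (outside ∷ A) (inside  ∷ B) = trans (cong suc (∣∪∣+∣∩∣ A B)) (sym (ℕ.+-suc _ _))
∣∪∣+∣∩∣ (inside  ∷ A) (outside ∷ B) = cong suc (∣∪∣+∣∩∣ A B)
∣∪∣+∣∩∣ (inside  ∷ A) (inside  ∷ B) =
  cong suc (trans (ℕ.+-suc _ _) (trans (cong suc (∣∪∣+∣∩∣ A B)) (sym (ℕ.+-suc _ _))))

⊓-submodular : ∀ t {u v a b} → u + v ≤ a + b → v ≤ a → v ≤ b →
               (u ⊓ t) + (v ⊓ t) ≤ (a ⊓ t) + (b ⊓ t)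
⊓-submodular t {u} {v} {a} {b} uv≤ab v≤a v≤b with ℕ.≤-total a t | ℕ.≤-total b t
... | inj₁ a≤t | inj₁ b≤t rewrite ℕ.m≤n⇒m⊓n≡m a≤t | ℕ.m≤n⇒m⊓n≡m b≤t =
  ℕ.≤-trans (ℕ.+-mono-≤ (ℕ.m⊓n≤m u t) (ℕ.m⊓n≤m v t)) uv≤ab
... | inj₁ a≤t | inj₂ t≤b rewrite ℕ.m≤n⇒m⊓n≡m a≤t | ℕ.m≥n⇒m⊓n≡n t≤b =
  ℕ.≤-trans (ℕ.+-mono-≤ (ℕ.m⊓n≤n u t) (ℕ.≤-trans (ℕ.m⊓n≤m v t) v≤a)) (ℕ.≤-reflexive (ℕ.+-comm t a))
... | inj₂ t≤a | inj₁ b≤t rewrite ℕ.m≥n⇒m⊓n≡n t≤a | ℕ.m≤n⇒m⊓n≡m b≤t =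
  ℕ.+-mono-≤ (ℕ.m⊓n≤n u t) (ℕ.≤-trans (ℕ.m⊓n≤m v t) v≤b)
... | inj₂ t≤a | inj₂ t≤b rewrite ℕ.m≥n⇒m⊓n≡n t≤a | ℕ.m≥n⇒m⊓n≡n t≤b =
  ℕ.+-mono-≤ (ℕ.m⊓n≤n u t) (ℕ.m⊓n≤n v t)

-- The matroid U_{t,X} ⊕ U_{0,E−X} on E = Fin m, for t ≤ ∣ X ∣.
uniform⊕loops : ∀ {m} → Subset m → ℕ → Matroid m
uniform⊕loops X t = record
  { rank       = λ A → ∣ A ∩ X ∣ ⊓ t
  ; bounded    = λ A → ℕ.≤-trans (ℕ.m⊓n≤m _ t) (∣p∩q∣≤∣p∣ A X)
  ; monotone   = λ {A} {B} A⊆B → ℕ.⊓-monoˡ-≤ t (mono {A} {B} A⊆B)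
  ; submodular = λ A B → ⊓-submodular t
      (ℕ.≤-reflexive (modular A B))
      (mono {A ∩ B} {A} (p∩q⊆p A B)) (mono {A ∩ B} {B} (p∩q⊆q A B))
  }
  where
  mono : ∀ {A B} → A ⊆ B → ∣ A ∩ X ∣ ≤ ∣ B ∩ X ∣
  mono {A} {B} A⊆B = p⊆q⇒∣p∣≤∣q∣ {p = A ∩ X} {q = B ∩ X} λ x∈ →
    let x∈A , x∈X = x∈p∩q⁻ A X x∈ in x∈p∩q⁺ (A⊆B x∈A , x∈X)

  ∩-∩ : ∀ A B → (A ∩ B) ∩ X ≡ (A ∩ X) ∩ (B ∩ X)
  ∩-∩ A B = trans (cong ((A ∩ B) ∩_) (sym (∩-idem X)))
           (trans (sym (∩-assoc (A ∩ B) X X))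
           (trans (cong (_∩ X) (trans (∩-assoc A B X)
                                (trans (cong (A ∩_) (∩-comm B X)) (sym (∩-assoc A X B)))))
                  (∩-assoc (A ∩ X) B X)))

  modular : ∀ A B → ∣ (A ∪ B) ∩ X ∣ + ∣ (A ∩ B) ∩ X ∣ ≡ ∣ A ∩ X ∣ + ∣ B ∩ X ∣
  modular A B = trans (cong₂ (λ C D → ∣ C ∣ + ∣ D ∣) (∩-distribʳ-∪ X A B) (∩-∩ A B))
                      (∣∪∣+∣∩∣ (A ∩ X) (B ∩ X))

sumOfMatroids : ∀ {m n} → (Fin n → Matroid m) → Polymatroid m
sumOfMatroids M = record
  { rank       = λ A → + Σ[ (λ i → Matroid.rank (M i) A) ]
  ; normalized = cong +_ (Σ-zero (λ i → Matroid.normalized (M i)))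
  ; monotone   = λ A⊆B → +≤+ (Σ-mono-≤ (λ i → Matroid.monotone (M i) A⊆B))
  ; submodular = λ A B → +≤+ (subst₂ _≤_ (Σ-distrib-+ (r (A ∪ B)) (r (A ∩ B)))
                                         (Σ-distrib-+ (r A) (r B))
                                         (Σ-mono-≤ (λ i → Matroid.submodular (M i) A B)))
  }
  where
  r : Subset _ → Fin _ → ℕ
  r A i = Matroid.rank (M i) A

-- The polymatroid ρ(A) = Σᵢ min { ∣A ∩ Xᵢ∣ , tᵢ }; it is the sum of the
-- rank functions of the matroids uniform⊕loops (X i) (t i).
ρ : ∀ {m n} → Hypergraph m n → (Fin n → ℕ) → Polymatroid m
ρ H t = record
  { rank       = λ A → + Σ[ (λ i → ∣ A ∩ X i ∣ ⊓ t i) ]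
  ; normalized = S.normalized
  ; monotone   = S.monotone
  ; submodular = S.submodular
  }
  where
  open Hypergraph H
  module S = Polymatroid (sumOfMatroids (λ i → uniform⊕loops (X i) (t i)))

-- For a matroid N let d_N(S) be the nullity of the set of non-loops of N in S.
-- It is linear in the rank function, monotone and supermodular, so for every
-- decomposition ρ = r_{N₁} + ⋯ + r_{Nₖ} the numbers d_{Nⱼ}(S) add up to
-- Σᵢ max(0, |S ∩ Xᵢ| − tᵢ).  For S ⊆ Xᵢ only the i-th term survives by (H2), and
-- supermodularity forces all of it, when tᵢ < |Xᵢ|, into a single Nⱼ: this j is
-- the color of i.  If two such hyperedges with the same color j met in e,
-- eliminating e from circuits in Nⱼ would give a deficit that must come from
-- parallel pairs {a, b} ⊆ Xₗ with tₗ = 1.  Exchanging a for b rules this out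
-- unless both t's are 1, and then a count on four points leaves only the triangle
-- excluded by (H3).  One-point hyperedges {e} get a remaining Nⱼ in which e is not
-- a loop.  Finally the color classes bound the r_{Nⱼ} from above by
-- subadditivity, and equality holds because both families add up to ρ.

{-# OPTIONS --safe #-}
module Submission where

open import Defs
import Algebra.Properties.CommutativeMonoid.Sum as Sum
open import Data.Fin.Base using (Fin; zero; suc; punchIn; punchOut; finToFun; funToFin; combine)
import Data.Fin.Properties as Fin
open import Data.Fin.Subset
  using (Subset; inside; outside; _∈_; _∉_; _⊆_; _∩_; _∪_; _─_; _-_; ∣_∣; Nonempty; ⁅_⁆)
  renaming (⊥ to ∅)
open import Data.Fin.Subset.Properties
open import Data.Nat.Base hiding (∣_-_∣)
open import Data.Nat.Properties
open import Algebra.Properties.CommutativeSemigroup +-commutativeSemigroup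
  using (interchange; xy∙z≈xz∙y; x∙yz≈y∙xz)
open import Data.Empty using (⊥)
open import Data.Product.Base using (∃; ∃₂; _×_; _,_; proj₁; proj₂)
open import Data.Sum.Base using (_⊎_; inj₁; inj₂; [_,_]′)
open import Data.Vec.Base using ([]; _∷_; here; there)
open import Function.Base using (_∘_; id; case_of_)
open import Relation.Binary.PropositionalEquality
open import Relation.Nullary.Decidable using (Dec; yes; no; ¬?; _×-dec_)
open import Relation.Nullary.Negation using (¬_; contradiction)
import Data.Integer.Base as ℤ
open import Data.Integer.Properties using (+-injective)
open import Data.List.Base as List using (List; filter; lookup; allFin)
open import Data.List.Extrema.Nat using (v≤min⁺)
open import Data.List.Membership.Propositional using () renaming (_∈_ to _∈ˡ_)
open import Data.List.Membership.Propositional.Properties using (∈-lookup; ∈-filter⁺; ∈-filter⁻; ∈-allFin; ∈-length)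
import Data.List.Relation.Unary.All as All
import Data.List.Relation.Unary.All.Properties as All
import Data.List.Relation.Unary.AllPairs as AllPairs
import Data.List.Relation.Unary.Any as Any
open import Data.List.Relation.Unary.Any.Properties using (lookup-index)
open import Data.List.Relation.Unary.Unique.Propositional using (Unique)
import Data.List.Relation.Unary.Unique.Propositional.Properties as Unique
open import Function.Bundles using (Bijection)
open import Function.Construct.Composition using (bijection)

-- Ranks alone do not locate a hyperedge: a point e is a non-loop in several of the Nⱼ, and it is
-- not known beforehand in which. A set of total deficit zero has deficit zero in every Nⱼ, and over
-- such an intersection supermodularity becomes superadditivity. Most local steps have this shape:
-- two sets meeting in a point, or in an independent subset of one Xᵢ, have deficits that add up in
-- the union, and deleting a point from a set costs at most one. The obstacle is that a single Nⱼ
-- may concentrate deficits of several hyperedges. For the three sides of a triangle {a, b, c}, each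
-- with t = 1, the sum of U of rank 1 and U of rank 2 on {a, b, c} is another decomposition, and
-- there all three sides are parallel pairs of the same Nⱼ although they meet. The four-point count
-- shows that this is the only such configuration. A one-point hyperedge has no deficit at all, so
-- its color is governed by loops instead, both when it is chosen and when it is recovered.

private
  variable
    m n k : ℕ

-- Finite sums and elementary inequalities.

Σ-cong : {f g : Fin n → ℕ} → (∀ i → f i ≡ g i) → Σ[ f ] ≡ Σ[ g ]
Σ-cong = Sum.sum-cong-≗ +-0-commutativeMonoid

Σ-comm : (f : Fin m → Fin n → ℕ) →
         Σ[ (λ i → Σ[ f i ]) ] ≡ Σ[ (λ j → Σ[ (λ i → f i j) ]) ]
Σ-comm = Sum.∑-comm +-0-commutativeMonoid

term≤Σ : (f : Fin n → ℕ) → ∀ i → f i ≤ Σ[ f ]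
term≤Σ f zero    = m≤m+n _ _
term≤Σ f (suc i) = ≤-trans (term≤Σ (f ∘ suc) i) (m≤n+m _ _)

two-terms≤Σ : (f : Fin n → ℕ) → ∀ {i j} → i ≢ j → f i + f j ≤ Σ[ f ]
two-terms≤Σ f {zero}  {zero}  i≢j = contradiction refl i≢j
two-terms≤Σ f {zero}  {suc j} i≢j = +-monoʳ-≤ (f zero) (term≤Σ (f ∘ suc) j)
two-terms≤Σ f {suc i} {zero}  i≢j =
  ≤-trans (≤-reflexive (+-comm (f (suc i)) _)) (+-monoʳ-≤ (f zero) (term≤Σ (f ∘ suc) i))
two-terms≤Σ f {suc i} {suc j} i≢j =
  ≤-trans (two-terms≤Σ (f ∘ suc) (i≢j ∘ cong suc)) (m≤n+m _ _)

three-terms≤Σ : (f : Fin n → ℕ) → ∀ {i j l} → i ≢ j → i ≢ l → j ≢ l → f i + (f j + f l) ≤ Σ[ f ]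
three-terms≤Σ {suc n} f {i} {j} {l} i≢j i≢l j≢l = begin
  f i + (f j + f l)                         ≡⟨ cong₂ (λ x y → f i + (f x + f y)) (Fin.punchIn-punchOut i≢j) (Fin.punchIn-punchOut i≢l) ⟨
  f i + (f (punchIn i (punchOut i≢j)) + f (punchIn i (punchOut i≢l)))
    ≤⟨ +-monoʳ-≤ (f i) (two-terms≤Σ (f ∘ punchIn i) (j≢l ∘ Fin.punchOut-injective i≢j i≢l)) ⟩
  f i + Σ[ f ∘ punchIn i ]                  ≡⟨ Sum.sum-remove +-0-commutativeMonoid f ⟨
  Σ[ f ]                                    ∎
  where open ≤-Reasoning

Σ-single : (f : Fin n → ℕ) → ∀ i → (∀ j → j ≢ i → f j ≡ 0) → Σ[ f ] ≡ f i
Σ-single f zero    z =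
  trans (cong (f zero +_) (Σ-zero (λ j → z (suc j) λ ()))) (+-identityʳ _)
Σ-single f (suc i) z =
  trans (cong (_+ Σ[ f ∘ suc ]) (z zero λ ()))
        (Σ-single (f ∘ suc) i λ j j≢i → z (suc j) (j≢i ∘ Fin.suc-injective))

Σ-positive : (f : Fin n → ℕ) → 0 < Σ[ f ] → ∃ λ i → 0 < f i
Σ-positive {suc n} f 0<Σ with f zero in eq
... | suc _ = zero , subst (0 <_) (sym eq) z<s
... | zero with i , p ← Σ-positive (f ∘ suc) 0<Σ = suc i , p

Σ-at-most-one : (f : Fin n → ℕ) {b : ℕ} → (∀ i → f i ≤ b) →
                (∀ {i j} → 0 < f i → 0 < f j → i ≡ j) → Σ[ f ] ≤ b
Σ-at-most-one f f≤b unique with Fin.any? (λ i → 0 <? f i)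
... | no none = ≤-trans (≤-reflexive (Σ-zero λ i → n≤0⇒n≡0 (≮⇒≥ λ 0<fi → none (i , 0<fi)))) z≤n
... | yes (i , 0<fi) = ≤-trans
  (≤-reflexive (Σ-single f i λ j j≢i → n≤0⇒n≡0 (≮⇒≥ λ 0<fj → j≢i (unique 0<fj 0<fi)))) (f≤b i)

-- This is how a bound on the whole decomposition becomes one on a single matroid: a termwise
-- inequality between families with the same total is termwise an equality.
Σ-squeeze : {f g : Fin n → ℕ} → (∀ i → f i ≤ g i) → Σ[ g ] ≤ Σ[ f ] → ∀ i → g i ≤ f i
Σ-squeeze {f = f} {g} f≤g Σg≤Σf zero =
  +-cancelʳ-≤ Σ[ g ∘ suc ] _ _ (≤-trans Σg≤Σf (+-monoʳ-≤ (f zero) (Σ-mono-≤ (f≤g ∘ suc))))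
Σ-squeeze {f = f} {g} f≤g Σg≤Σf (suc i) = Σ-squeeze (f≤g ∘ suc)
  (+-cancelˡ-≤ (g zero) _ _ (≤-trans Σg≤Σf (+-monoˡ-≤ _ (f≤g zero)))) i

Σ-mono-≤-except : {f g : Fin n → ℕ} (j : Fin n) {c : ℕ} →
  (∀ i → i ≢ j → f i ≤ g i) → f j ≤ g j + c → Σ[ f ] ≤ Σ[ g ] + c
Σ-mono-≤-except {f = f} {g} zero {c} f≤g fj≤ = begin
  f zero + Σ[ f ∘ suc ]       ≤⟨ +-mono-≤ fj≤ (Σ-mono-≤ λ i → f≤g (suc i) λ ()) ⟩
  g zero + c + Σ[ g ∘ suc ]   ≡⟨ +-assoc (g zero) c _ ⟩
  g zero + (c + Σ[ g ∘ suc ]) ≡⟨ cong (g zero +_) (+-comm c _) ⟩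
  g zero + (Σ[ g ∘ suc ] + c) ≡⟨ +-assoc (g zero) _ c ⟨
  g zero + Σ[ g ∘ suc ] + c   ∎
  where open ≤-Reasoning
Σ-mono-≤-except {f = f} {g} (suc j) {c} f≤g fj≤ =
  ≤-trans (+-mono-≤ (f≤g zero λ ())
                    (Σ-mono-≤-except j (λ i i≢j → f≤g (suc i) (i≢j ∘ Fin.suc-injective)) fj≤))
          (≤-reflexive (sym (+-assoc (g zero) _ c)))

Σ-distrib-+₃ : (u v w : Fin n → ℕ) → Σ[ (λ i → u i + v i + w i) ] ≡ Σ[ u ] + Σ[ v ] + Σ[ w ]
Σ-distrib-+₃ u v w = trans (Σ-distrib-+ (λ i → u i + v i) w) (cong (_+ Σ[ w ]) (Σ-distrib-+ u v))

-- As `z` is at most 1, the pairwise bounds leave at most one of the three numbers nonzero. For `z`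
-- equal to 2 the triple 1, 1, 1 is a counterexample, and this is why a matroid holding two units of
-- deficit has to be treated separately.
three≤one : ∀ u v w {z} → u + v ≤ z → u + w ≤ z → v + w ≤ z → z ≤ 1 → u + v + w ≤ z
three≤one zero    v w _  _  vw _  = vw
three≤one (suc u) v w uv uw _  z≤1
  with refl ← n≤0⇒n≡0 (m+n≤o⇒n≤o u (s≤s⁻¹ (≤-trans uv z≤1))) =
  subst (λ x → suc x + w ≤ _) (sym (+-identityʳ u)) uw

m+[n∸m]<o : ∀ {m n o} → m < o → n < o → m + (n ∸ m) < o
m+[n∸m]<o {m} {n} m<o n<o with ≤-total n m
... | inj₁ n≤m = subst (_< _) (sym (trans (cong (m +_) (m≤n⇒m∸n≡0 n≤m)) (+-identityʳ m))) m<o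
... | inj₂ m≤n = subst (_< _) (sym (m+[n∸m]≡n m≤n)) n<o

m+[n∸1]≤o : ∀ {m} n {o} → m ≤ o → m + n ≤ o + 1 → m + (n ∸ 1) ≤ o
m+[n∸1]≤o {m} zero    m≤o _  = ≤-trans (≤-reflexive (+-identityʳ m)) m≤o
m+[n∸1]≤o {m} (suc n) _   le = s≤s⁻¹ (≤-trans (≤-reflexive (sym (+-suc m n))) (≤-trans le (≤-reflexive (+-comm _ 1))))

-- Weighted cardinalities.

weight : (Fin m → ℕ) → Subset m → ℕ
weight f []            = 0
weight f (inside  ∷ S) = f zero + weight (f ∘ suc) S
weight f (outside ∷ S) = weight (f ∘ suc) S

weight-∅ : (f : Fin m → ℕ) → weight f ∅ ≡ 0
weight-∅ {zero}  f = refl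
weight-∅ {suc m} f = weight-∅ (f ∘ suc)

weight-⁅⁆ : (f : Fin m → ℕ) → ∀ x → weight f ⁅ x ⁆ ≡ f x
weight-⁅⁆ f zero    = trans (cong (f zero +_) (weight-∅ (f ∘ suc))) (+-identityʳ _)
weight-⁅⁆ f (suc x) = weight-⁅⁆ (f ∘ suc) x

weight-cong : {f g : Fin m → ℕ} → (∀ x → f x ≡ g x) → ∀ S → weight f S ≡ weight g S
weight-cong f≡g []            = refl
weight-cong f≡g (inside  ∷ S) = cong₂ _+_ (f≡g zero) (weight-cong (f≡g ∘ suc) S)
weight-cong f≡g (outside ∷ S) = weight-cong (f≡g ∘ suc) S

weight-mono-≤ : {f g : Fin m → ℕ} (S : Subset m) → (∀ {x} → x ∈ S → f x ≤ g x) →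
                weight f S ≤ weight g S
weight-mono-≤ []            f≤g = z≤n
weight-mono-≤ (inside  ∷ S) f≤g = +-mono-≤ (f≤g here) (weight-mono-≤ S (f≤g ∘ there))
weight-mono-≤ (outside ∷ S) f≤g = weight-mono-≤ S (f≤g ∘ there)

weight-one : (S : Subset m) → weight (λ _ → 1) S ≡ ∣ S ∣
weight-one []            = refl
weight-one (inside  ∷ S) = cong suc (weight-one S)
weight-one (outside ∷ S) = weight-one S

weight-modular : (f : Fin m → ℕ) (A B : Subset m) →
                 weight f (A ∪ B) + weight f (A ∩ B) ≡ weight f A + weight f B
weight-modular f []            []            = refl
weight-modular f (outside ∷ A) (outside ∷ B) = weight-modular (f ∘ suc) A B
weight-modular f (inside  ∷ A) (outside ∷ B) =
  trans (+-assoc (f zero) _ _)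
        (trans (cong (f zero +_) (weight-modular (f ∘ suc) A B)) (sym (+-assoc (f zero) _ _)))
weight-modular f (outside ∷ A) (inside  ∷ B) =
  trans (+-assoc (f zero) _ _)
        (trans (cong (f zero +_) (weight-modular (f ∘ suc) A B))
               (x∙yz≈y∙xz (f zero) (weight (f ∘ suc) A) _))
weight-modular f (inside  ∷ A) (inside  ∷ B) =
  trans (interchange (f zero) _ (f zero) _)
        (trans (cong (f zero + f zero +_) (weight-modular (f ∘ suc) A B))
               (interchange (f zero) (f zero) _ _))

weight-Σ : (f : Fin n → Fin m → ℕ) (S : Subset m) →
           Σ[ (λ j → weight (f j) S) ] ≡ weight (λ x → Σ[ (λ j → f j x) ]) S
weight-Σ {n} f []            = Σ-zero {n} λ _ → refl
weight-Σ f (inside  ∷ S) = trans (Σ-distrib-+ (λ j → f j zero) _)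
                                 (cong (_ +_) (weight-Σ (λ j → f j ∘ suc) S))
weight-Σ f (outside ∷ S) = weight-Σ (λ j → f j ∘ suc) S

weight-∣⁅⁆∩∣ : (S X : Subset m) → weight (λ x → ∣ ⁅ x ⁆ ∩ X ∣) S ≡ ∣ S ∩ X ∣
weight-∣⁅⁆∩∣ [] [] = refl
weight-∣⁅⁆∩∣ {suc m} (inside ∷ S) (inside ∷ X) =
  cong₂ _+_ (cong suc (trans (cong ∣_∣ (∩-zeroˡ X)) (∣⊥∣≡0 m))) (weight-∣⁅⁆∩∣ S X)
weight-∣⁅⁆∩∣ {suc m} (inside ∷ S) (outside ∷ X) =
  cong₂ _+_ (trans (cong ∣_∣ (∩-zeroˡ X)) (∣⊥∣≡0 m)) (weight-∣⁅⁆∩∣ S X)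
weight-∣⁅⁆∩∣ (outside ∷ S) (_ ∷ X) = weight-∣⁅⁆∩∣ S X

weight-⊆ : (f : Fin m → ℕ) {A B : Subset m} → A ⊆ B → weight f A ≤ weight f B
weight-⊆ f {[]}          {[]}          A⊆B = z≤n
weight-⊆ f {inside  ∷ A} {inside  ∷ B} A⊆B = +-monoʳ-≤ (f zero) (weight-⊆ (f ∘ suc) (drop-∷-⊆ A⊆B))
weight-⊆ f {inside  ∷ A} {outside ∷ B} A⊆B = contradiction (A⊆B here) λ ()
weight-⊆ f {outside ∷ A} {inside  ∷ B} A⊆B = ≤-trans (weight-⊆ (f ∘ suc) (drop-∷-⊆ A⊆B)) (m≤n+m _ _)
weight-⊆ f {outside ∷ A} {outside ∷ B} A⊆B = weight-⊆ (f ∘ suc) (drop-∷-⊆ A⊆B)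

term≤weight : (f : Fin m → ℕ) {S : Subset m} {x : Fin m} → x ∈ S → f x ≤ weight f S
term≤weight f here                         = m≤m+n _ _
term≤weight f {inside  ∷ S} (there x∈S) = ≤-trans (term≤weight (f ∘ suc) x∈S) (m≤n+m _ _)
term≤weight f {outside ∷ S} (there x∈S) = term≤weight (f ∘ suc) x∈S

weight-positive : (f : Fin m → ℕ) (S : Subset m) → 0 < weight f S → ∃ λ x → x ∈ S × 0 < f x
weight-positive f (outside ∷ S) 0<w
  with x , x∈S , p ← weight-positive (f ∘ suc) S 0<w = suc x , there x∈S , p
weight-positive f (inside ∷ S) 0<w with f zero in eq
... | suc _ = zero , here , subst (0 <_) (sym eq) z<s
... | zero with x , x∈S , p ← weight-positive (f ∘ suc) S 0<w = suc x , there x∈S , p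

-- Subsets.

x∈p─q⇒x∉q : (p q : Subset m) → ∀ {x} → x ∈ p ─ q → x ∉ q
x∈p─q⇒x∉q (_ ∷ p) (inside  ∷ q) (there x∈) (there x∈q) = x∈p─q⇒x∉q p q x∈ x∈q
x∈p─q⇒x∉q (_ ∷ p) (outside ∷ q) (there x∈) (there x∈q) = x∈p─q⇒x∉q p q x∈ x∈q

module _ {m : ℕ} where

  ⁅⁆⊆ : ∀ {x : Fin m} {S} → x ∈ S → ⁅ x ⁆ ⊆ S
  ⁅⁆⊆ {x} {S} x∈S y∈ = subst (_∈ S) (sym (x∈⁅y⁆⇒x≡y x y∈)) x∈S

  ∪-lub : ∀ {A B S : Subset m} → A ⊆ S → B ⊆ S → A ∪ B ⊆ S
  ∪-lub {A} {B} A⊆S B⊆S = [ A⊆S , B⊆S ]′ ∘ x∈p∪q⁻ A B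

  ∪ˡ : ∀ {A B : Subset m} → A ⊆ A ∪ B
  ∪ˡ {A} {B} = p⊆p∪q B

  ∪ʳ : ∀ {A B : Subset m} → B ⊆ A ∪ B
  ∪ʳ {A} {B} = q⊆p∪q A B

  ⊆-∪-─ : ∀ (A B : Subset m) → B ⊆ A ∪ (B ─ A)
  ⊆-∪-─ A B {x} x∈B with x ∈? A
  ... | yes x∈A = ∪ˡ x∈A
  ... | no  x∉A = ∪ʳ {A} (x∈p∧x∉q⇒x∈p─q x∈B x∉A)

  ∩-⊆-common : ∀ {A B I : Subset m} {x y} → x ≢ y → A ⊆ I ∪ ⁅ x ⁆ → B ⊆ I ∪ ⁅ y ⁆ →
               ∀ {z} → z ∈ A → z ∈ B → z ∈ I
  ∩-⊆-common {A} {B} {I} {x} {y} x≢y A⊆ B⊆ z∈A z∈B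
    with x∈p∪q⁻ I ⁅ x ⁆ (A⊆ z∈A) | x∈p∪q⁻ I ⁅ y ⁆ (B⊆ z∈B)
  ... | inj₁ z∈I | _        = z∈I
  ... | inj₂ _   | inj₁ z∈I = z∈I
  ... | inj₂ z∈x | inj₂ z∈y =
    contradiction (trans (sym (x∈⁅y⁆⇒x≡y x z∈x)) (x∈⁅y⁆⇒x≡y y z∈y)) x≢y

  disjoint-∩≡∅ : ∀ {A B : Subset m} → (∀ {x} → x ∈ A → x ∉ B) → A ∩ B ≡ ∅
  disjoint-∩≡∅ {A} {B} disj = Empty-unique λ (x , x∈) →
    let x∈A , x∈B = x∈p∩q⁻ A B x∈ in disj x∈A x∈B

  weight-disjoint : (f : Fin m → ℕ) {A B : Subset m} → (∀ {x} → x ∈ A → x ∉ B) →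
                    weight f (A ∪ B) ≡ weight f A + weight f B
  weight-disjoint f {A} {B} disj = begin
    weight f (A ∪ B)                     ≡⟨ +-identityʳ _ ⟨
    weight f (A ∪ B) + 0                 ≡⟨ cong (weight f (A ∪ B) +_) (weight-∅ f) ⟨
    weight f (A ∪ B) + weight f ∅        ≡⟨ cong (λ I → weight f (A ∪ B) + weight f I) (disjoint-∩≡∅ {A} {B} disj) ⟨
    weight f (A ∪ B) + weight f (A ∩ B)  ≡⟨ weight-modular f A B ⟩
    weight f A + weight f B              ∎
    where open ≡-Reasoning

  ∣∪∣-disjoint : ∀ {A B : Subset m} → (∀ {x} → x ∈ A → x ∉ B) → ∣ A ∪ B ∣ ≡ ∣ A ∣ + ∣ B ∣
  ∣∪∣-disjoint {A} {B} disj =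
    trans (sym (weight-one (A ∪ B)))
          (trans (weight-disjoint (λ _ → 1) {A} {B} disj) (cong₂ _+_ (weight-one A) (weight-one B)))

  ∣∪∣≤∣∣+∣∣ : ∀ (A B : Subset m) → ∣ A ∪ B ∣ ≤ ∣ A ∣ + ∣ B ∣
  ∣∪∣≤∣∣+∣∣ A B = m+n≤o⇒m≤o ∣ A ∪ B ∣ (≤-reflexive (∣∪∣+∣∩∣ A B))

  x∉⇒disjoint : ∀ {x : Fin m} {S} → x ∉ S → ∀ {y} → y ∈ S → y ∉ ⁅ x ⁆
  x∉⇒disjoint {x} {S} x∉S y∈S y∈x = x∉S (subst (_∈ S) (x∈⁅y⁆⇒x≡y x y∈x) y∈S)

  ∪-⁅⁆-common : ∀ {A S : Subset m} {b} → b ∉ S → ∀ {x} → x ∈ A ∪ S → x ∈ A ∪ ⁅ b ⁆ → x ∈ A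
  ∪-⁅⁆-common {A} {S} {b} b∉S x∈AS x∈Ab with x∈p∪q⁻ A S x∈AS | x∈p∪q⁻ A ⁅ b ⁆ x∈Ab
  ... | inj₁ x∈A | _        = x∈A
  ... | inj₂ _   | inj₁ x∈A = x∈A
  ... | inj₂ x∈S | inj₂ x∈b = contradiction x∈b (x∉⇒disjoint b∉S x∈S)

  ∣∪⁅⁆∣ : ∀ {x : Fin m} {S} → x ∉ S → ∣ S ∪ ⁅ x ⁆ ∣ ≡ suc ∣ S ∣
  ∣∪⁅⁆∣ {x} {S} x∉S =
    trans (∣∪∣-disjoint {S} (x∉⇒disjoint x∉S)) (trans (cong (∣ S ∣ +_) (∣⁅x⁆∣≡1 x)) (+-comm _ 1))

  ∣pair∣≤2 : ∀ (x y : Fin m) → ∣ ⁅ x ⁆ ∪ ⁅ y ⁆ ∣ ≤ 2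
  ∣pair∣≤2 x y = ≤-trans (∣∪∣≤∣∣+∣∣ ⁅ x ⁆ ⁅ y ⁆) (≤-reflexive (cong₂ _+_ (∣⁅x⁆∣≡1 x) (∣⁅x⁆∣≡1 y)))

  ∣pair∣≡2 : ∀ {x y : Fin m} → x ≢ y → ∣ ⁅ x ⁆ ∪ ⁅ y ⁆ ∣ ≡ 2
  ∣pair∣≡2 {x} {y} x≢y =
    trans (∣∪⁅⁆∣ {y} (x≢y ∘ sym ∘ x∈⁅y⁆⇒x≡y x)) (cong suc (∣⁅x⁆∣≡1 x))

  ∣-─∣+∣-∣≤∣-∣ : ∀ {A B : Subset m} → A ⊆ B → ∣ B ─ A ∣ + ∣ A ∣ ≤ ∣ B ∣
  ∣-─∣+∣-∣≤∣-∣ {A} {B} A⊆B =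
    ≤-trans (≤-reflexive (sym (∣∪∣-disjoint {B ─ A} (x∈p─q⇒x∉q B A))))
            (p⊆q⇒∣p∣≤∣q∣ (∪-lub {B ─ A} (p─q⊆p B A) A⊆B))

  ∣⊆∣-one : ∀ {S : Subset m} → (∀ {x y} → x ∈ S → y ∈ S → x ≡ y) → ∣ S ∣ ≤ 1
  ∣⊆∣-one {S} unique with nonempty? S
  ... | no empty       = ≤-trans (≤-reflexive (trans (cong ∣_∣ (Empty-unique empty)) (∣⊥∣≡0 m))) z≤n
  ... | yes (x , x∈S) = ≤-trans (p⊆q⇒∣p∣≤∣q∣ {p = S} λ y∈S → subst (_∈ ⁅ x ⁆) (unique x∈S y∈S) (x∈⁅x⁆ x))
                                (≤-reflexive (∣⁅x⁆∣≡1 x))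

  ∣-∣≤1⇒≡ : ∀ {S : Subset m} → ∣ S ∣ ≤ 1 → ∀ {x y} → x ∈ S → y ∈ S → x ≡ y
  ∣-∣≤1⇒≡ {S} ∣S∣≤1 {x} {y} x∈S y∈S with x Fin.≟ y
  ... | yes x≡y = x≡y
  ... | no  x≢y = contradiction
    (≤-trans (≤-reflexive (sym (∣pair∣≡2 x≢y)))
             (≤-trans (p⊆q⇒∣p∣≤∣q∣ (∪-lub {⁅ x ⁆} (⁅⁆⊆ x∈S) (⁅⁆⊆ y∈S))) ∣S∣≤1)) λ where (s≤s ())

  0<∣-∣⇒nonempty : ∀ (S : Subset m) → 0 < ∣ S ∣ → Nonempty S
  0<∣-∣⇒nonempty S 0<∣S∣ with x , x∈S , _ ← weight-positive (λ _ → 1) S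
                                (subst (0 <_) (sym (weight-one S)) 0<∣S∣) = x , x∈S

  nonempty⇒0<∣-∣ : ∀ {S : Subset m} {x} → x ∈ S → 0 < ∣ S ∣
  nonempty⇒0<∣-∣ {S} {x} x∈S = ≤-trans (≤-reflexive (sym (∣⁅x⁆∣≡1 x))) (p⊆q⇒∣p∣≤∣q∣ {p = ⁅ x ⁆} (⁅⁆⊆ x∈S))

  ∣-∣≤1+∣-─⁅⁆∣ : ∀ (S : Subset m) x → ∣ S ∣ ≤ suc ∣ S - x ∣
  ∣-∣≤1+∣-─⁅⁆∣ S x = begin
    ∣ S ∣                     ≤⟨ p⊆q⇒∣p∣≤∣q∣ (⊆-∪-─ ⁅ x ⁆ S) ⟩
    ∣ ⁅ x ⁆ ∪ (S - x) ∣       ≤⟨ ∣∪∣≤∣∣+∣∣ ⁅ x ⁆ (S - x) ⟩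
    ∣ ⁅ x ⁆ ∣ + ∣ S - x ∣     ≡⟨ cong (_+ ∣ S - x ∣) (∣⁅x⁆∣≡1 x) ⟩
    suc ∣ S - x ∣             ∎
    where open ≤-Reasoning

  x∉p-x : ∀ (p : Subset m) x → x ∉ p - x
  x∉p-x p x x∈ = x∈p─q⇒x∉q p ⁅ x ⁆ x∈ (x∈⁅x⁆ x)

  another-element : ∀ {S : Subset m} → 2 ≤ ∣ S ∣ → ∀ x → ∃ λ y → y ∈ S × y ≢ x
  another-element {S} 2≤∣S∣ x
    with y , y∈ ← 0<∣-∣⇒nonempty (S - x) (s≤s⁻¹ (≤-trans 2≤∣S∣ (∣-∣≤1+∣-─⁅⁆∣ S x))) =
    y , p─q⊆p S ⁅ x ⁆ y∈ , λ y≡x → x∉p-x S x (subst (_∈ S - x) y≡x y∈)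

subset-of-size : ∀ {s} (S : Subset m) → s ≤ ∣ S ∣ → ∃ λ A → A ⊆ S × ∣ A ∣ ≡ s
subset-of-size {m} {zero}  S z≤n = ∅ , ⊆-min S , ∣⊥∣≡0 m
subset-of-size {s = suc s} (inside ∷ S) (s≤s s≤)
  with A , A⊆S , eq ← subset-of-size S s≤ = inside ∷ A , in⊆in A⊆S , cong suc eq
subset-of-size {s = suc s} (outside ∷ S) s≤
  with A , A⊆S , eq ← subset-of-size S s≤ = outside ∷ A , out⊆ A⊆S , eq

subset-induction : ∀ {ℓ} (K : Subset m → Set ℓ) → K ∅ →
                   (∀ {S x} → x ∉ S → K S → K (S ∪ ⁅ x ⁆)) → ∀ S → K S
subset-induction {zero}  K base step [] = base
subset-induction {suc m} K base step = λ where
    (outside ∷ S) → outer S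
    (inside  ∷ S) → subst (λ T → K (inside ∷ T)) (∪-identityʳ S) (step {x = zero} (λ ()) (outer S))
  where
  outer : ∀ S → K (outside ∷ S)
  outer = subset-induction (K ∘ (outside ∷_)) base λ {_} {x} x∉S →
            step {x = suc x} (λ where (there x∈S) → x∉S x∈S)

weight-∪⁅⁆ : (f : Fin m → ℕ) {S : Subset m} {x : Fin m} → x ∉ S →
             weight f (S ∪ ⁅ x ⁆) ≡ weight f S + f x
weight-∪⁅⁆ f {S} {x} x∉S =
  trans (weight-disjoint f {S} (x∉⇒disjoint x∉S)) (cong (weight f S +_) (weight-⁅⁆ f x))

-- The term `g ∅` is kept on the left because in `Concentration.color` it is the deficit of the
-- circuit from which the extension starts.
superadditive-≥ : (g : Subset m → ℕ) (f : Fin m → ℕ) →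
  (∀ {S x} → x ∉ S → g S + f x ≤ g (S ∪ ⁅ x ⁆)) → ∀ S → g ∅ + weight f S ≤ g S
superadditive-≥ g f step = subset-induction _
  (≤-reflexive (trans (cong (g ∅ +_) (weight-∅ f)) (+-identityʳ _)))
  λ {S} {x} x∉S ih → begin
    g ∅ + weight f (S ∪ ⁅ x ⁆)  ≡⟨ cong (g ∅ +_) (weight-∪⁅⁆ f x∉S) ⟩
    g ∅ + (weight f S + f x)    ≡⟨ +-assoc (g ∅) _ _ ⟨
    g ∅ + weight f S + f x      ≤⟨ +-monoˡ-≤ (f x) ih ⟩
    g S + f x                   ≤⟨ step x∉S ⟩
    g (S ∪ ⁅ x ⁆)               ∎
  where open ≤-Reasoning

subadditive-≤ : (g : Subset m → ℕ) (f : Fin m → ℕ) → g ∅ ≡ 0 →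
  (∀ {S x} → x ∉ S → g (S ∪ ⁅ x ⁆) ≤ g S + f x) → ∀ S → g S ≤ weight f S
subadditive-≤ g f g∅≡0 step = subset-induction _
  (≤-reflexive (trans g∅≡0 (sym (weight-∅ f))))
  λ {S} {x} x∉S ih →
    ≤-trans (step x∉S) (≤-trans (+-monoˡ-≤ (f x) ih) (≤-reflexive (sym (weight-∪⁅⁆ f x∉S))))

-- Deficits.

module _ {m : ℕ} (N : Matroid m) where

  open Matroid N

  private
    s : Subset m → ℕ
    s = weight (λ x → rank ⁅ x ⁆)

  rank-∪-≤ : ∀ A B → rank (A ∪ B) ≤ rank A + rank B
  rank-∪-≤ A B = m+n≤o⇒m≤o (rank (A ∪ B)) (submodular A B)

  rank-⁅⁆≤1 : ∀ x → rank ⁅ x ⁆ ≤ 1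
  rank-⁅⁆≤1 x = ≤-trans (bounded ⁅ x ⁆) (≤-reflexive (∣⁅x⁆∣≡1 x))

  rank≤weight : ∀ S → rank S ≤ weight (λ x → rank ⁅ x ⁆) S
  rank≤weight = subadditive-≤ rank _ normalized λ {S} {x} _ → rank-∪-≤ S ⁅ x ⁆

  weight-rank≤∣-∣ : ∀ S → weight (λ x → rank ⁅ x ⁆) S ≤ ∣ S ∣
  weight-rank≤∣-∣ S =
    ≤-trans (weight-mono-≤ S λ {x} _ → rank-⁅⁆≤1 x) (≤-reflexive (weight-one S))

  opaque
    -- The nullity of the set of non-loops of N in S.
    deficit : Subset m → ℕ
    deficit S = weight (λ x → rank ⁅ x ⁆) S ∸ rank S

    rank+deficit : ∀ S → rank S + deficit S ≡ weight (λ x → rank ⁅ x ⁆) S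
    rank+deficit S = m+[n∸m]≡n (rank≤weight S)

    deficit-⁅⁆ : ∀ x → deficit ⁅ x ⁆ ≡ 0
    deficit-⁅⁆ x = trans (cong (_∸ rank ⁅ x ⁆) (weight-⁅⁆ _ x)) (n∸n≡0 (rank ⁅ x ⁆))

  -- Passing from A to B raises the weight by the number of non-loops added, and the rank by no more
  -- than that.
  deficit-mono : ∀ {A B} → A ⊆ B → deficit A ≤ deficit B
  deficit-mono {A} {B} A⊆B = +-cancelˡ-≤ (rank B) _ _ (begin
    rank B + deficit A                ≤⟨ +-monoˡ-≤ _ (monotone {B} {A ∪ (B ─ A)} (⊆-∪-─ A B)) ⟩
    rank (A ∪ (B ─ A)) + deficit A    ≤⟨ +-monoˡ-≤ _ (rank-∪-≤ A (B ─ A)) ⟩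
    rank A + rank (B ─ A) + deficit A ≤⟨ +-monoˡ-≤ _ (+-monoʳ-≤ (rank A) (rank≤weight (B ─ A))) ⟩
    rank A + s (B ─ A) + deficit A    ≡⟨ xy∙z≈xz∙y (rank A) (s (B ─ A)) _ ⟩
    rank A + deficit A + s (B ─ A)    ≡⟨ cong (_+ s (B ─ A)) (rank+deficit A) ⟩
    s A + s (B ─ A)                   ≡⟨ weight-disjoint _ {A} (λ x∈A x∈ → x∈p─q⇒x∉q B A x∈ x∈A) ⟨
    s (A ∪ (B ─ A))                   ≤⟨ weight-⊆ _ {A ∪ (B ─ A)} (∪-lub {A = A} A⊆B (p─q⊆p B A)) ⟩
    s B                               ≡⟨ rank+deficit B ⟨
    rank B + deficit B                ∎)
    where open ≤-Reasoning

  -- The rank does not decrease when T is added, so the deficit grows by at most the number of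
  -- non-loops in T. Read backwards, deleting a point costs at most one unit of deficit.
  deficit-∪-≤ : ∀ {U} A T → U ⊆ A ∪ T → deficit U ≤ deficit A + s T
  deficit-∪-≤ {U} A T U⊆ = ≤-trans (deficit-mono U⊆) (+-cancelˡ-≤ (rank (A ∪ T)) _ _ (begin
    rank (A ∪ T) + deficit (A ∪ T)    ≡⟨ rank+deficit (A ∪ T) ⟩
    s (A ∪ T)                         ≤⟨ m+n≤o⇒m≤o _ (≤-reflexive (weight-modular _ A T)) ⟩
    s A + s T                         ≡⟨ cong (_+ s T) (rank+deficit A) ⟨
    rank A + deficit A + s T          ≡⟨ +-assoc (rank A) _ _ ⟩
    rank A + (deficit A + s T)        ≤⟨ +-monoˡ-≤ _ (monotone {A} ∪ˡ) ⟩
    rank (A ∪ T) + (deficit A + s T)  ∎))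
    where open ≤-Reasoning

  deficit-∪⁅⁆-≤ : ∀ {U} A x → U ⊆ A ∪ ⁅ x ⁆ → deficit U ≤ deficit A + rank ⁅ x ⁆
  deficit-∪⁅⁆-≤ A x U⊆ =
    ≤-trans (deficit-∪-≤ A ⁅ x ⁆ U⊆) (≤-reflexive (cong (deficit A +_) (weight-⁅⁆ _ x)))

  deficit-∪⁅⁆-≤1 : ∀ {U} A x → U ⊆ A ∪ ⁅ x ⁆ → deficit U ≤ suc (deficit A)
  deficit-∪⁅⁆-≤1 A x U⊆ = ≤-trans (deficit-∪⁅⁆-≤ A x U⊆)
    (≤-trans (+-monoʳ-≤ (deficit A) (rank-⁅⁆≤1 x)) (≤-reflexive (+-comm (deficit A) 1)))

  deficit-∪-∩ : ∀ A B → deficit A + deficit B ≤ deficit (A ∪ B) + deficit (A ∩ B)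
  deficit-∪-∩ A B = +-cancelˡ-≤ (rank (A ∪ B) + rank (A ∩ B)) _ _ (begin
    rank (A ∪ B) + rank (A ∩ B) + (deficit A + deficit B)              ≤⟨ +-monoˡ-≤ _ (submodular A B) ⟩
    rank A + rank B + (deficit A + deficit B)                          ≡⟨ interchange (rank A) _ _ _ ⟩
    (rank A + deficit A) + (rank B + deficit B)                        ≡⟨ cong₂ _+_ (rank+deficit A) (rank+deficit B) ⟩
    s A + s B                                                          ≡⟨ weight-modular _ A B ⟨
    s (A ∪ B) + s (A ∩ B)                                              ≡⟨ cong₂ _+_ (rank+deficit (A ∪ B)) (rank+deficit (A ∩ B)) ⟨
    (rank (A ∪ B) + deficit (A ∪ B)) + (rank (A ∩ B) + deficit (A ∩ B)) ≡⟨ interchange (rank (A ∪ B)) _ _ _ ⟩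
    rank (A ∪ B) + rank (A ∩ B) + (deficit (A ∪ B) + deficit (A ∩ B))  ∎)
    where open ≤-Reasoning

  -- Monotonicity lets any superset U of the union and any superset I of the intersection stand in
  -- for them, so that applications need only membership proofs and no set identities.
  deficit-supermodular : ∀ {A B U I} → A ⊆ U → B ⊆ U → (∀ {x} → x ∈ A → x ∈ B → x ∈ I) →
                         deficit A + deficit B ≤ deficit U + deficit I
  deficit-supermodular {A} {B} A⊆U B⊆U A∩B⊆I = ≤-trans (deficit-∪-∩ A B)
    (+-mono-≤ (deficit-mono {A ∪ B} (∪-lub {A = A} A⊆U B⊆U))
              (deficit-mono {A ∩ B} λ x∈ → let x∈A , x∈B = x∈p∩q⁻ A B x∈ in A∩B⊆I x∈A x∈B))

  deficit-superadditive : ∀ {A B U I} → A ⊆ U → B ⊆ U → (∀ {x} → x ∈ A → x ∈ B → x ∈ I) →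
                          deficit I ≡ 0 → deficit A + deficit B ≤ deficit U
  deficit-superadditive {U = U} A⊆U B⊆U A∩B⊆I dI≡0 =
    ≤-trans (deficit-supermodular A⊆U B⊆U A∩B⊆I)
            (≤-reflexive (trans (cong (deficit U +_) dI≡0) (+-identityʳ _)))

  -- The two pairs meet in b, which has deficit zero, so the three points have deficit at least 2,
  -- and deleting b leaves at least 1. For `a` equal to `c` the remaining set would be a point, of
  -- deficit zero.
  parallel-trans : ∀ {a b c} → a ≢ c → 0 < deficit (⁅ a ⁆ ∪ ⁅ b ⁆) → 0 < deficit (⁅ b ⁆ ∪ ⁅ c ⁆) →
                   0 < deficit (⁅ a ⁆ ∪ ⁅ c ⁆)
  parallel-trans {a} {b} {c} a≢c ab bc = s≤s⁻¹ (begin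
    2                                              ≤⟨ +-mono-≤ ab bc ⟩
    deficit (⁅ a ⁆ ∪ ⁅ b ⁆) + deficit (⁅ b ⁆ ∪ ⁅ c ⁆)
      ≤⟨ deficit-superadditive {⁅ a ⁆ ∪ ⁅ b ⁆} {⁅ b ⁆ ∪ ⁅ c ⁆}
           (∪-lub {A = ⁅ a ⁆} (∪ˡ ∘ ∪ˡ) (∪ʳ {A = ⁅ a ⁆ ∪ ⁅ c ⁆})) (∪-lub {A = ⁅ b ⁆} (∪ʳ {A = ⁅ a ⁆ ∪ ⁅ c ⁆}) (∪ˡ ∘ (∪ʳ {A = ⁅ a ⁆})))
           (∩-⊆-common a≢c (∪-lub {A = ⁅ a ⁆} (∪ʳ {A = ⁅ b ⁆}) ∪ˡ) id) (deficit-⁅⁆ b) ⟩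
    deficit ((⁅ a ⁆ ∪ ⁅ c ⁆) ∪ ⁅ b ⁆)              ≤⟨ deficit-∪⁅⁆-≤1 (⁅ a ⁆ ∪ ⁅ c ⁆) b id ⟩
    suc (deficit (⁅ a ⁆ ∪ ⁅ c ⁆))                  ∎)
    where open ≤-Reasoning

  -- For non-loops, deficit (⁅ a ⁆ ∪ ⁅ b ⁆) is 1 or 0 as a, b are parallel or not.
  deficit-pairs : ∀ P Q → deficit P ≡ 0 →
    weight (λ b → weight (λ a → deficit (⁅ a ⁆ ∪ ⁅ b ⁆)) P) Q ≤ deficit (P ∪ Q)
  deficit-pairs P Q dP≡0 = begin
    weight (λ b → weight (λ a → deficit (⁅ a ⁆ ∪ ⁅ b ⁆)) P) Q ≤⟨ weight-mono-≤ Q (λ {b} _ → star b) ⟩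
    weight (λ b → deficit (P ∪ ⁅ b ⁆)) Q                      ≤⟨ m+n≤o⇒n≤o _ (superadditive-≥ (λ S → deficit (P ∪ S)) _ step Q) ⟩
    deficit (P ∪ Q)                                           ∎
    where
    open ≤-Reasoning

    -- The sets P ∪ {b} for different b meet only in P, and in `star` the pairs {a, b} with b fixed
    -- meet only in {b}. Both intersections have deficit zero, so the deficits add up.
    step : ∀ {S b} → b ∉ S → deficit (P ∪ S) + deficit (P ∪ ⁅ b ⁆) ≤ deficit (P ∪ (S ∪ ⁅ b ⁆))
    step {S} {b} b∉S = deficit-superadditive {P ∪ S} {P ∪ ⁅ b ⁆}
      (∪-lub {A = P} ∪ˡ (∪ʳ {A = P} ∘ ∪ˡ)) (∪-lub {A = P} ∪ˡ (∪ʳ {A = P} ∘ ∪ʳ {A = S})) (∪-⁅⁆-common b∉S) dP≡0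

    star : ∀ b → weight (λ a → deficit (⁅ a ⁆ ∪ ⁅ b ⁆)) P ≤ deficit (P ∪ ⁅ b ⁆)
    star b = m+n≤o⇒n≤o _ (superadditive-≥ (λ S → deficit (S ∪ ⁅ b ⁆)) _ add P)
      where
      add : ∀ {S a} → a ∉ S →
            deficit (S ∪ ⁅ b ⁆) + deficit (⁅ a ⁆ ∪ ⁅ b ⁆) ≤ deficit ((S ∪ ⁅ a ⁆) ∪ ⁅ b ⁆)
      add {S} {a} a∉S = deficit-superadditive {S ∪ ⁅ b ⁆} {⁅ a ⁆ ∪ ⁅ b ⁆}
        (∪-lub {A = S} (∪ˡ ∘ ∪ˡ) (∪ʳ {A = S ∪ ⁅ a ⁆})) (∪-lub {A = ⁅ a ⁆} (∪ˡ ∘ ∪ʳ {A = S}) (∪ʳ {A = S ∪ ⁅ a ⁆}))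
        common (deficit-⁅⁆ b)
        where
        common : ∀ {x} → x ∈ S ∪ ⁅ b ⁆ → x ∈ ⁅ a ⁆ ∪ ⁅ b ⁆ → x ∈ ⁅ b ⁆
        common x∈Sb x∈ab with x∈p∪q⁻ S ⁅ b ⁆ x∈Sb | x∈p∪q⁻ ⁅ a ⁆ ⁅ b ⁆ x∈ab
        ... | inj₂ x∈b | _        = x∈b
        ... | inj₁ _   | inj₂ x∈b = x∈b
        ... | inj₁ x∈S | inj₁ x∈a = contradiction x∈a (x∉⇒disjoint a∉S x∈S)

  -- Covering the non-loops suffices, since a set of loops has rank zero. In the application, points
  -- of A on no hyperedge of color j are loops of N j and lie in none of the covering sets.
  rank-cover : ∀ {n} (B : Fin n → Subset m) A →
    (∀ {x} → x ∈ A → 0 < rank ⁅ x ⁆ → ∃ λ i → x ∈ B i) → rank A ≤ Σ[ (λ i → rank (B i)) ]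
  rank-cover {zero} B A cover = ≤-trans (rank≤weight A) (≮⇒≥ λ 0<w →
    let x , x∈A , 0<r = weight-positive _ A 0<w in case cover x∈A 0<r of λ ())
  rank-cover {suc n} B A cover = begin
    rank A                                      ≤⟨ monotone {A} (⊆-∪-─ (B zero) A) ⟩
    rank (B zero ∪ (A ─ B zero))                ≤⟨ rank-∪-≤ (B zero) _ ⟩
    rank (B zero) + rank (A ─ B zero)           ≤⟨ +-monoʳ-≤ (rank (B zero)) (rank-cover (B ∘ suc) (A ─ B zero) rest) ⟩
    rank (B zero) + Σ[ (λ i → rank (B (suc i))) ] ∎
    where
    open ≤-Reasoning
    rest : ∀ {x} → x ∈ A ─ B zero → 0 < rank ⁅ x ⁆ → ∃ λ i → x ∈ B (suc i)
    rest x∈ 0<r with cover (p─q⊆p A (B zero) x∈) 0<r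
    ... | zero  , x∈B = contradiction x∈B (x∈p─q⇒x∉q A (B zero) x∈)
    ... | suc i , x∈B = i , x∈B

-- The deficit depends linearly on the rank function.
Σ-deficit : (M : Fin n → Matroid m) (N : Fin k → Matroid m) →
  (∀ A → Σ[ (λ i → Matroid.rank (M i) A) ] ≡ Σ[ (λ j → Matroid.rank (N j) A) ]) →
  ∀ A → Σ[ (λ i → deficit (M i) A) ] ≡ Σ[ (λ j → deficit (N j) A) ]
Σ-deficit {m = m} M N eq A = +-cancelˡ-≡ Σ[ (λ i → Matroid.rank (M i) A) ] _ _ (begin
  Σ[ (λ i → Matroid.rank (M i) A) ] + Σ[ (λ i → deficit (M i) A) ] ≡⟨ total M ⟩
  weight (λ x → Σ[ (λ i → Matroid.rank (M i) ⁅ x ⁆) ]) A           ≡⟨ weight-cong (λ x → eq ⁅ x ⁆) A ⟩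
  weight (λ x → Σ[ (λ j → Matroid.rank (N j) ⁅ x ⁆) ]) A           ≡⟨ total N ⟨
  Σ[ (λ j → Matroid.rank (N j) A) ] + Σ[ (λ j → deficit (N j) A) ] ≡⟨ cong (_+ Σ[ (λ j → deficit (N j) A) ]) (eq A) ⟨
  Σ[ (λ i → Matroid.rank (M i) A) ] + Σ[ (λ j → deficit (N j) A) ] ∎)
  where
  open ≡-Reasoning
  total : ∀ {l} (L : Fin l → Matroid m) →
    Σ[ (λ i → Matroid.rank (L i) A) ] + Σ[ (λ i → deficit (L i) A) ] ≡
    weight (λ x → Σ[ (λ i → Matroid.rank (L i) ⁅ x ⁆) ]) A
  total L = trans (sym (Σ-distrib-+ (λ i → Matroid.rank (L i) A) _))
           (trans (Σ-cong (λ i → rank+deficit (L i) A))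
                  (weight-Σ (λ i x → Matroid.rank (L i) ⁅ x ⁆) A))

-- Uniform matroids and sums without common non-loops.

∣⁅⁆∩∣≤1 : ∀ (x : Fin m) X → ∣ ⁅ x ⁆ ∩ X ∣ ≤ 1
∣⁅⁆∩∣≤1 x X = ≤-trans (∣p∩q∣≤∣p∣ ⁅ x ⁆ X) (≤-reflexive (∣⁅x⁆∣≡1 x))

-- For positive `t` the non-loops are exactly the points of X, so the weight of A is `∣ A ∩ X ∣`.
-- For `t` equal to 0 all points would be loops.
deficit-uniform⊕loops : ∀ (X : Subset m) {t} → 0 < t →
                        ∀ A → deficit (uniform⊕loops X t) A ≡ ∣ A ∩ X ∣ ∸ t
deficit-uniform⊕loops X {t} 0<t A = +-cancelˡ-≡ (∣ A ∩ X ∣ ⊓ t) _ _ (begin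
  ∣ A ∩ X ∣ ⊓ t + deficit (uniform⊕loops X t) A   ≡⟨ rank+deficit (uniform⊕loops X t) A ⟩
  weight (λ x → ∣ ⁅ x ⁆ ∩ X ∣ ⊓ t) A              ≡⟨ weight-cong (λ x → m≤n⇒m⊓n≡m (≤-trans (∣⁅⁆∩∣≤1 x X) 0<t)) A ⟩
  weight (λ x → ∣ ⁅ x ⁆ ∩ X ∣) A                  ≡⟨ weight-∣⁅⁆∩∣ A X ⟩
  ∣ A ∩ X ∣                                       ≡⟨ m⊓n+n∸m≡n t _ ⟨
  t ⊓ ∣ A ∩ X ∣ + (∣ A ∩ X ∣ ∸ t)                 ≡⟨ cong (_+ (∣ A ∩ X ∣ ∸ t)) (⊓-comm t _) ⟩
  ∣ A ∩ X ∣ ⊓ t + (∣ A ∩ X ∣ ∸ t)                 ∎)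
  where open ≡-Reasoning

loops : Matroid m
loops = record
  { rank = λ _ → 0 ; bounded = λ _ → z≤n ; monotone = λ _ → z≤n ; submodular = λ _ _ → z≤n }

-- A rank-zero matroid in place of an absent summand makes every color class a sum over all of
-- `Fin n`, so that sums over hyperedges and over colors can be exchanged.
when : ∀ {P : Set} → Dec P → Matroid m → Matroid m
when (yes _) M = M
when (no  _) M = loops

rank-when-yes : ∀ {P : Set} (P? : Dec P) {M : Matroid m} → P →
                ∀ A → Matroid.rank (when P? M) A ≡ Matroid.rank M A
rank-when-yes (yes _) p A = refl
rank-when-yes (no ¬p) p A = contradiction p ¬p

rank-when-no : ∀ {P : Set} (P? : Dec P) {M : Matroid m} → ¬ P →
               ∀ A → Matroid.rank (when P? M) A ≡ 0
rank-when-no (yes p) ¬p A = contradiction p ¬p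
rank-when-no (no _)  ¬p A = refl

-- The condition says that no point is a non-loop of two summands: up to loops, this is a direct
-- sum. It yields the bound by cardinality, since the rank of A is at most the number of pairs of a
-- summand and a non-loop of it in A.
sumMatroid : (M : Fin n → Matroid m) → (∀ x → Σ[ (λ i → Matroid.rank (M i) ⁅ x ⁆) ] ≤ 1) → Matroid m
sumMatroid M point≤1 = record
  { rank       = λ A → Σ[ (λ i → Matroid.rank (M i) A) ]
  ; bounded    = λ A → begin
      Σ[ (λ i → Matroid.rank (M i) A) ]                            ≤⟨ Σ-mono-≤ (λ i → rank≤weight (M i) A) ⟩
      Σ[ (λ i → weight (λ x → Matroid.rank (M i) ⁅ x ⁆) A) ]       ≡⟨ weight-Σ (λ i x → Matroid.rank (M i) ⁅ x ⁆) A ⟩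
      weight (λ x → Σ[ (λ i → Matroid.rank (M i) ⁅ x ⁆) ]) A       ≤⟨ weight-mono-≤ A (λ {x} _ → point≤1 x) ⟩
      weight (λ _ → 1) A                                           ≡⟨ weight-one A ⟩
      ∣ A ∣                                                        ∎
  ; monotone   = λ {A} {B} A⊆B → Σ-mono-≤ λ i → Matroid.monotone (M i) {A} {B} A⊆B
  ; submodular = λ A B → subst₂ _≤_
      (Σ-distrib-+ (λ i → Matroid.rank (M i) (A ∪ B)) (λ i → Matroid.rank (M i) (A ∩ B)))
      (Σ-distrib-+ (λ i → Matroid.rank (M i) A) (λ i → Matroid.rank (M i) B))
      (Σ-mono-≤ λ i → Matroid.submodular (M i) A B)
  }
  where open ≤-Reasoning

deficit-sumMatroid : (M : Fin n → Matroid m) (point≤1 : ∀ x → Σ[ (λ i → Matroid.rank (M i) ⁅ x ⁆) ] ≤ 1) →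
                     ∀ A → Σ[ (λ i → deficit (M i) A) ] ≡ deficit (sumMatroid M point≤1) A
deficit-sumMatroid M point≤1 A =
  trans (Σ-deficit M (λ (_ : Fin 1) → sumMatroid M point≤1) (λ _ → sym (+-identityʳ _)) A) (+-identityʳ _)

deficit-cong : (M N : Matroid m) → (∀ A → Matroid.rank M A ≡ Matroid.rank N A) →
               ∀ A → deficit M A ≡ deficit N A
deficit-cong M N same A = +-cancelʳ-≡ 0 _ _
  (Σ-deficit (λ (_ : Fin 1) → M) (λ (_ : Fin 1) → N) (λ B → cong (_+ 0) (same B)) A)

-- Sums of uniform matroids on the lines of a linear hypergraph.

module Lines {m n : ℕ} (X : Fin n → Subset m) (t : Fin n → ℕ) (0<t : ∀ i → 0 < t i)
  (linear : ∀ {i j x y} → i ≢ j → x ∈ X i → x ∈ X j → y ∈ X i → y ∈ X j → x ≡ y) where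

  opaque
    -- By `deficit-uniform⊕loops` this is the deficit of S in the l-th matroid of the given sum.
    -- Hence `total` is the sum of the deficits of S over the members of any decomposition.
    excess : Fin n → Subset m → ℕ
    excess l S = ∣ S ∩ X l ∣ ∸ t l

    excess-def : ∀ l S → excess l S ≡ ∣ S ∩ X l ∣ ∸ t l
    excess-def l S = refl

  total : Subset m → ℕ
  total S = Σ[ (λ l → excess l S) ]

  excess≡0 : ∀ l {A} → ∣ A ∩ X l ∣ ≤ t l → excess l A ≡ 0
  excess≡0 l {A} le = trans (excess-def l A) (m≤n⇒m∸n≡0 le)

  0<excess⇒ : ∀ l {A} → 0 < excess l A → t l < ∣ A ∩ X l ∣
  0<excess⇒ l {A} 0<e = m∸n≢0⇒n<m (>⇒≢ (subst (0 <_) (excess-def l A) 0<e))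

  excess-mono : ∀ l {A B} → (∀ {x} → x ∈ A → x ∈ X l → x ∈ B) → excess l A ≤ excess l B
  excess-mono l {A} {B} A⊆B = subst₂ _≤_ (sym (excess-def l A)) (sym (excess-def l B))
    (∸-monoˡ-≤ (t l) (p⊆q⇒∣p∣≤∣q∣ {p = A ∩ X l} λ x∈ →
      let x∈A , x∈X = x∈p∩q⁻ A (X l) x∈ in x∈p∩q⁺ (A⊆B x∈A x∈X , x∈X)))

  excess-one : ∀ l {A} → (∀ {x y} → x ∈ A → x ∈ X l → y ∈ A → y ∈ X l → x ≡ y) → excess l A ≡ 0
  excess-one l {A} unique = excess≡0 l {A} (≤-trans (∣⊆∣-one λ x∈ y∈ →
    let x∈A , x∈X = x∈p∩q⁻ A (X l) x∈; y∈A , y∈X = x∈p∩q⁻ A (X l) y∈ in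
    unique x∈A x∈X y∈A y∈X) (0<t l))

  total-⊆ : ∀ {i S} → S ⊆ X i → total S ≡ ∣ S ∣ ∸ t i
  total-⊆ {i} {S} S⊆X = trans
    (Σ-single _ i λ l l≢i → excess-one l λ x∈S x∈X y∈S y∈X → linear l≢i x∈X (S⊆X x∈S) y∈X (S⊆X y∈S))
    (trans (excess-def i S)
           (cong (λ s → ∣ s ∣ ∸ t i) (⊆-antisym (p∩q⊆p S (X i)) λ x∈S → x∈p∩q⁺ (x∈S , S⊆X x∈S))))

  total-⊆≡0 : ∀ {i S} → S ⊆ X i → ∣ S ∣ ≤ t i → total S ≡ 0
  total-⊆≡0 S⊆X ∣S∣≤t = trans (total-⊆ S⊆X) (m≤n⇒m∸n≡0 ∣S∣≤t)

  total-⁅⁆ : ∀ x → total ⁅ x ⁆ ≡ 0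
  total-⁅⁆ x = Σ-zero λ l → excess≡0 l {⁅ x ⁆} (≤-trans (∣⁅⁆∩∣≤1 x (X l)) (0<t l))

  -- Two points can exceed the positive number `t l` only if `t l` is 1 and both are on X l. If one
  -- of them were not, the intersection with X l would have at most one point and no excess.
  line-through : ∀ {a b} → 0 < total (⁅ a ⁆ ∪ ⁅ b ⁆) → ∃ λ l → t l ≡ 1 × a ∈ X l × b ∈ X l
  line-through {a} {b} 0<total with l , 0<e ← Σ-positive _ 0<total =
    l , ≤-antisym (s≤s⁻¹ (≤-trans t<∣∩∣ (≤-trans (∣p∩q∣≤∣p∣ (⁅ a ⁆ ∪ ⁅ b ⁆) (X l)) (∣pair∣≤2 a b)))) (0<t l) ,
    on-line (λ x∈ → x∈p∪q⁻ ⁅ a ⁆ ⁅ b ⁆ x∈) , on-line (λ x∈ → swap (x∈p∪q⁻ ⁅ a ⁆ ⁅ b ⁆ x∈))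
    where
    open import Data.Sum.Base using (swap)
    t<∣∩∣ : t l < ∣ (⁅ a ⁆ ∪ ⁅ b ⁆) ∩ X l ∣
    t<∣∩∣ = 0<excess⇒ l 0<e

    on-line : ∀ {c d} → (∀ {x} → x ∈ ⁅ a ⁆ ∪ ⁅ b ⁆ → x ∈ ⁅ c ⁆ ⊎ x ∈ ⁅ d ⁆) → c ∈ X l
    on-line {c} {d} cases with c ∈? X l
    ... | yes c∈X = c∈X
    ... | no  c∉X = contradiction 0<e (≤⇒≯ (≤-reflexive (excess-one l {⁅ a ⁆ ∪ ⁅ b ⁆} λ x∈ x∈X y∈ y∈X → trans (is-d x∈ x∈X) (sym (is-d y∈ y∈X)))))
      where
      is-d : ∀ {x} → x ∈ ⁅ a ⁆ ∪ ⁅ b ⁆ → x ∈ X l → x ≡ d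
      is-d x∈ x∈X with cases x∈
      ... | inj₁ x∈c = contradiction (subst (_∈ X l) (x∈⁅y⁆⇒x≡y c x∈c) x∈X) c∉X
      ... | inj₂ x∈d = x∈⁅y⁆⇒x≡y d x∈d

  -- The excess of a union of two sets.

  Transversal : Subset m → Subset m → Fin n → Set
  Transversal P Q l = (∀ {x} → x ∈ P → x ∉ X l) ⊎ (∀ {x} → x ∈ Q → x ∉ X l) ⊎
    ((∀ {x y} → x ∈ P → x ∈ X l → y ∈ P → y ∈ X l → x ≡ y) ×
     (∀ {x y} → x ∈ Q → x ∈ X l → y ∈ Q → y ∈ X l → x ≡ y))

  pairs : (Subset m → ℕ) → Subset m → Subset m → ℕ
  pairs f P Q = weight (λ b → weight (λ a → f (⁅ a ⁆ ∪ ⁅ b ⁆)) P) Q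

  Σ-pairs : ∀ {k} (f : Fin k → Subset m → ℕ) P Q →
            Σ[ (λ i → pairs (f i) P Q) ] ≡ pairs (λ S → Σ[ (λ i → f i S) ]) P Q
  Σ-pairs f P Q = trans (weight-Σ (λ i b → weight (λ a → f i (⁅ a ⁆ ∪ ⁅ b ⁆)) P) Q)
    (weight-cong (λ b → weight-Σ (λ i a → f i (⁅ a ⁆ ∪ ⁅ b ⁆)) P) Q)

  pairs-term : ∀ f {P Q a b} → a ∈ P → b ∈ Q → f (⁅ a ⁆ ∪ ⁅ b ⁆) ≤ pairs f P Q
  pairs-term f {P} a∈P b∈Q =
    ≤-trans (term≤weight (λ a → f (⁅ a ⁆ ∪ ⁅ _ ⁆)) a∈P)
            (term≤weight (λ b → weight (λ a → f (⁅ a ⁆ ∪ ⁅ b ⁆)) P) b∈Q)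

  excess-∪ : ∀ {P Q} l → Transversal P Q l →
             excess l (P ∪ Q) ≤ excess l P + excess l Q + pairs (excess l) P Q
  excess-∪ {P} {Q} l (inj₁ P∩X) = ≤-trans
    (excess-mono l {P ∪ Q} {Q} λ x∈ x∈X → [ (λ x∈P → contradiction x∈X (P∩X x∈P)) , id ]′ (x∈p∪q⁻ P Q x∈))
    (≤-trans (m≤n+m _ (excess l P)) (m≤m+n _ _))
  excess-∪ {P} {Q} l (inj₂ (inj₁ Q∩X)) = ≤-trans
    (excess-mono l {P ∪ Q} {P} λ x∈ x∈X → [ id , (λ x∈Q → contradiction x∈X (Q∩X x∈Q)) ]′ (x∈p∪q⁻ P Q x∈))
    (≤-trans (m≤m+n _ (excess l Q)) (m≤m+n _ _))
  excess-∪ {P} {Q} l (inj₂ (inj₂ (uP , uQ))) with nonempty? (P ∩ X l) | nonempty? (Q ∩ X l)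
  ... | no empty | _ = excess-∪ {P} {Q} l (inj₁ λ x∈P x∈X → empty (_ , x∈p∩q⁺ (x∈P , x∈X)))
  ... | yes _ | no empty = excess-∪ {P} {Q} l (inj₂ (inj₁ λ x∈Q x∈X → empty (_ , x∈p∩q⁺ (x∈Q , x∈X))))
  ... | yes (a , a∈) | yes (b , b∈)
    with a∈P , a∈X ← x∈p∩q⁻ P (X l) a∈ | b∈Q , b∈X ← x∈p∩q⁻ Q (X l) b∈ = ≤-trans
    (excess-mono l {P ∪ Q} {⁅ a ⁆ ∪ ⁅ b ⁆} λ x∈ x∈X → [
        (λ x∈P → ∪ˡ (subst (_∈ ⁅ a ⁆) (uP a∈P a∈X x∈P x∈X) (x∈⁅x⁆ a))) ,
        (λ x∈Q → ∪ʳ {A = ⁅ a ⁆} (subst (_∈ ⁅ b ⁆) (uQ b∈Q b∈X x∈Q x∈X) (x∈⁅x⁆ b))) ]′ (x∈p∪q⁻ P Q x∈))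
    (≤-trans (pairs-term (excess l) a∈P b∈Q) (m≤n+m _ _))

  total-∪ : ∀ {P Q} → (∀ l → Transversal P Q l) → total (P ∪ Q) ≤ total P + total Q + pairs total P Q
  total-∪ {P} {Q} trv = ≤-trans (Σ-mono-≤ λ l → excess-∪ {P} {Q} l (trv l)) (≤-reflexive
    (trans (Σ-distrib-+₃ (λ l → excess l P) (λ l → excess l Q) (λ l → pairs (excess l) P Q))
           (cong (total P + total Q +_) (Σ-pairs excess P Q))))

  -- The deficits of an arbitrary decomposition.

  module Decomposition {k : ℕ} (N : Fin k → Matroid m)
    (decomposes : ∀ A → Σ[ (λ i → ∣ A ∩ X i ∣ ⊓ t i) ] ≡ Σ[ (λ j → Matroid.rank (N j) A) ]) where

    d : Fin k → Subset m → ℕ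
    d j = deficit (N j)

    Σd≡total : ∀ S → Σ[ (λ j → d j S) ] ≡ total S
    Σd≡total S = trans (sym (Σ-deficit (λ i → uniform⊕loops (X i) (t i)) N decomposes S))
                       (Σ-cong λ i → trans (deficit-uniform⊕loops (X i) (0<t i) S) (sym (excess-def i S)))

    d≤total : ∀ j S → d j S ≤ total S
    d≤total j S = ≤-trans (term≤Σ _ j) (≤-reflexive (Σd≡total S))

    d+d≤total : ∀ {i j} → i ≢ j → ∀ S → d i S + d j S ≤ total S
    d+d≤total i≢j S = ≤-trans (two-terms≤Σ _ i≢j) (≤-reflexive (Σd≡total S))

    total≡0⇒d≡0 : ∀ {S} → total S ≡ 0 → ∀ j → d j S ≡ 0
    total≡0⇒d≡0 {S} eq j = n≤0⇒n≡0 (≤-trans (d≤total j S) (≤-reflexive eq))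

    -- Both sides count parallel pairs between P and Q, so the bounds
    -- deficit-pairs and total-∪ are attained for every N j.
    parallel-pair : ∀ {P Q} → (∀ l → Transversal P Q l) → total P ≡ 0 → total Q ≡ 0 →
      ∀ {j} → 0 < d j (P ∪ Q) → ∃₂ λ a b → a ∈ P × b ∈ Q × 0 < d j (⁅ a ⁆ ∪ ⁅ b ⁆)
    parallel-pair {P} {Q} trv tP≡0 tQ≡0 {j} 0<d =
      let b , b∈Q , 0<w = weight-positive _ Q (≤-trans 0<d tight)
          a , a∈P , 0<dab = weight-positive _ P 0<w
      in a , b , a∈P , b∈Q , 0<dab
      where
      open ≤-Reasoning
      tight : d j (P ∪ Q) ≤ pairs (d j) P Q
      tight = Σ-squeeze (λ i → deficit-pairs (N i) P Q (total≡0⇒d≡0 tP≡0 i)) (begin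
        Σ[ (λ i → d i (P ∪ Q)) ]               ≡⟨ Σd≡total (P ∪ Q) ⟩
        total (P ∪ Q)                          ≤⟨ total-∪ trv ⟩
        total P + total Q + pairs total P Q    ≡⟨ cong₂ (λ u v → u + v + pairs total P Q) tP≡0 tQ≡0 ⟩
        pairs total P Q                        ≡⟨ weight-cong (λ b → weight-cong (λ a → Σd≡total (⁅ a ⁆ ∪ ⁅ b ⁆)) P) Q ⟨
        pairs (λ S → Σ[ (λ i → d i S) ]) P Q   ≡⟨ Σ-pairs d P Q ⟨
        Σ[ (λ i → pairs (d i) P Q) ]           ∎) j

    -- For tᵢ < |Xᵢ|: Xᵢ has rank tᵢ and no loops in N j.
    Color : Fin n → Fin k → Set
    Color i j = ∣ X i ∣ ≤ t i + d j (X i)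

    -- Existence of a color for a hyperedge with t < |X|.

    module _ {i} (t<∣X∣ : t i < ∣ X i ∣) where

      private
        total-circuit : ∀ {Z} → Z ⊆ X i → ∣ Z ∣ ≡ suc (t i) → total Z ≡ 1
        total-circuit Z⊆X eq = trans (total-⊆ Z⊆X) (trans (cong (_∸ t i) eq) (m+n∸n≡m 1 (t i)))

        module Extension {A} (A⊆X : A ⊆ X i) (∣A∣≡ : ∣ A ∣ ≡ suc (t i))
                         {a b} (a∈A : a ∈ A) (b∈A : b ∈ A) (b≢a : b ≢ a)
                         {x} (x∈X : x ∈ X i) (x∉A : x ∉ A) where

          Y : Subset m
          Y = A ∪ ⁅ x ⁆

          Y⊆X : Y ⊆ X i
          Y⊆X = ∪-lub {A = A} A⊆X (⁅⁆⊆ x∈X)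

          total-Y : total Y ≡ 2
          total-Y = trans (total-⊆ Y⊆X) (trans (cong (_∸ t i) (trans (∣∪⁅⁆∣ x∉A) (cong suc ∣A∣≡))) (m+n∸n≡m 2 (t i)))

          swapped : Fin m → Subset m
          swapped c = (A - c) ∪ ⁅ x ⁆

          swapped⊆Y : ∀ c → swapped c ⊆ Y
          swapped⊆Y c = ∪-lub {A = A - c} (∪ˡ ∘ p─q⊆p A ⁅ c ⁆) (∪ʳ {A = A})

          ∣A-c∣≡t : ∀ {c} → c ∈ A → ∣ A - c ∣ ≡ t i
          ∣A-c∣≡t {c} c∈A = ≤-antisym
            (s≤s⁻¹ (≤-trans (x∈p⇒∣p-x∣<∣p∣ c∈A) (≤-reflexive ∣A∣≡)))
            (s≤s⁻¹ (≤-trans (≤-reflexive (sym ∣A∣≡)) (∣-∣≤1+∣-─⁅⁆∣ A c)))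

          ∣swapped∣ : ∀ {c} → c ∈ A → ∣ swapped c ∣ ≡ suc (t i)
          ∣swapped∣ {c} c∈A = trans (∣∪⁅⁆∣ (x∉A ∘ p─q⊆p A ⁅ c ⁆)) (cong suc (∣A-c∣≡t c∈A))

          total-swapped : ∀ {c} → c ∈ A → total (swapped c) ≡ 1
          total-swapped {c} c∈A = total-circuit (Y⊆X ∘ swapped⊆Y c) (∣swapped∣ c∈A)

          independent : ∀ j {Z} → Z ⊆ X i → ∣ Z ∣ ≤ t i → d j Z ≡ 0
          independent j Z⊆X ∣Z∣≤t = total≡0⇒d≡0 (total-⊆≡0 Z⊆X ∣Z∣≤t) j

          -- The circuits A and `swapped c` of the uniform matroid on X i meet in A without c, a set
          -- of `t i` points and hence of total 0. The same happens for `swapped a` and `swapped b`,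
          -- so in N j the deficits of any two of the three circuits add up inside Y.
          A+swapped : ∀ j {c} → c ∈ A → d j A + d j (swapped c) ≤ d j Y
          A+swapped j {c} c∈A = deficit-superadditive (N j) {A} {swapped c} ∪ˡ (swapped⊆Y c)
            (λ y∈A y∈ → [ id , (λ y∈x → contradiction y∈x (x∉⇒disjoint x∉A y∈A)) ]′ (x∈p∪q⁻ (A - c) ⁅ x ⁆ y∈))
            (independent j (A⊆X ∘ p─q⊆p A ⁅ c ⁆) (≤-reflexive (∣A-c∣≡t c∈A)))

          swapped+swapped : ∀ j → d j (swapped a) + d j (swapped b) ≤ d j Y
          swapped+swapped j = deficit-superadditive (N j) {swapped a} {swapped b} (swapped⊆Y a) (swapped⊆Y b)
            (λ y∈a y∈b → x∈p∧x≢y⇒x∈p-y y∈a λ y≡b → b∉swapped-b (subst (_∈ swapped b) y≡b y∈b))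
            (independent j (Y⊆X ∘ swapped⊆Y a ∘ p─q⊆p (swapped a) ⁅ b ⁆)
              (s≤s⁻¹ (≤-trans (x∈p⇒∣p-x∣<∣p∣ b∈swapped-a) (≤-reflexive (∣swapped∣ a∈A)))))
            where
            b∈swapped-a : b ∈ swapped a
            b∈swapped-a = ∪ˡ (x∈p∧x≢y⇒x∈p-y b∈A b≢a)
            b∉swapped-b : b ∉ swapped b
            b∉swapped-b b∈ = [ x∉p-x A b , x∉⇒disjoint x∉A b∈A ]′ (x∈p∪q⁻ (A - b) ⁅ x ⁆ b∈)

          -- The three circuits A, swapped a, swapped b ⊆ Y lie in the N j, but
          -- the total deficit of Y is 2, so two of them lie in the same N j.
          concentrated : ∃ λ j → 2 ≤ d j Y
          concentrated with Fin.any? (λ j → 2 ≤? d j Y)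
          ... | yes found = found
          ... | no none = contradiction (begin-strict
            2                             <⟨ n<1+n 2 ⟩
            3                             ≡⟨ cong₂ _+_ (cong₂ _+_ (total-circuit A⊆X ∣A∣≡) (total-swapped a∈A)) (total-swapped b∈A) ⟨
            total A + total (swapped a) + total (swapped b)
              ≡⟨ cong₂ _+_ (cong₂ _+_ (Σd≡total A) (Σd≡total (swapped a))) (Σd≡total (swapped b)) ⟨
            _                             ≡⟨ Σ-distrib-+₃ (λ j → d j A) (λ j → d j (swapped a)) (λ j → d j (swapped b)) ⟨
            Σ[ (λ j → d j A + d j (swapped a) + d j (swapped b)) ]
              ≤⟨ Σ-mono-≤ (λ j → three≤one (d j A) (d j (swapped a)) (d j (swapped b))
                   (A+swapped j a∈A) (A+swapped j b∈A) (swapped+swapped j)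
                   (s≤s⁻¹ (≰⇒> λ 2≤ → none (j , 2≤)))) ⟩
            Σ[ (λ j → d j Y) ]            ≡⟨ Σd≡total Y ⟩
            total Y                       ≡⟨ total-Y ⟩
            2                             ∎) (<-irrefl refl)
            where open ≤-Reasoning

          -- Deleting x from Y leaves positive deficit on A in the matroid found by `concentrated`.
          -- The total of A is 1, so that matroid is the given N j. Thus one and the same j serves
          -- every x outside A.
          extend : ∀ {j} → 0 < d j A → 2 ≤ d j Y
          extend {j} 0<dA with concentrated
          ... | l , 2≤dY with l Fin.≟ j
          ... | yes refl = 2≤dY
          ... | no l≢j = contradiction (≤-trans
            (+-mono-≤ (s≤s⁻¹ (≤-trans 2≤dY (deficit-∪⁅⁆-≤1 (N l) {Y} A x id))) 0<dA)
            (≤-trans (d+d≤total l≢j A) (≤-reflexive (total-circuit A⊆X ∣A∣≡)))) λ where (s≤s ())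

      module Concentration {A} (A⊆X : A ⊆ X i) (∣A∣≡ : ∣ A ∣ ≡ suc (t i))
                           {a b} (a∈A : a ∈ A) (b∈A : b ∈ A) (b≢a : b ≢ a)
                           {j} (0<dA : 0 < d j A) where

        dA≤1 : d j A ≤ 1
        dA≤1 = ≤-trans (d≤total j A) (≤-reflexive (total-circuit A⊆X ∣A∣≡))

        gain : Fin m → ℕ
        gain x = d j (A ∪ ⁅ x ⁆) ∸ 1

        gain≥1 : ∀ {x} → x ∈ X i ─ A → 1 ≤ gain x
        gain≥1 x∈ = ∸-monoˡ-≤ 1 (Extension.extend A⊆X ∣A∣≡ a∈A b∈A b≢a
          (p─q⊆p (X i) A x∈) (x∈p─q⇒x∉q (X i) A x∈) 0<dA)

        -- Supermodularity over A counts the deficit of A twice, and this deficit is at most 1. This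
        -- is the unit that `gain` subtracts.
        step : ∀ {S x} → x ∉ S → d j (A ∪ S) + gain x ≤ d j (A ∪ (S ∪ ⁅ x ⁆))
        step {S} {x} x∉S = m+[n∸1]≤o (d j (A ∪ ⁅ x ⁆))
          (deficit-mono (N j) {A ∪ S} (∪-lub {A = A} ∪ˡ (∪ʳ {A = A} ∘ ∪ˡ)))
          (≤-trans (deficit-supermodular (N j) {A ∪ S} {A ∪ ⁅ x ⁆} {A ∪ (S ∪ ⁅ x ⁆)}
                     (∪-lub {A = A} ∪ˡ (∪ʳ {A = A} ∘ ∪ˡ)) (∪-lub {A = A} ∪ˡ (∪ʳ {A = A} ∘ ∪ʳ {A = S}))
                     (∪-⁅⁆-common x∉S))
                   (+-monoʳ-≤ (d j (A ∪ (S ∪ ⁅ x ⁆))) dA≤1))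

        -- The circuit A has `t i` + 1 points and contributes one unit of deficit, and each further
        -- point of X i contributes at least one more.
        color : Color i j
        color = begin
          ∣ X i ∣                              ≤⟨ p⊆q⇒∣p∣≤∣q∣ (⊆-∪-─ A (X i)) ⟩
          ∣ A ∪ (X i ─ A) ∣                    ≤⟨ ∣∪∣≤∣∣+∣∣ A (X i ─ A) ⟩
          ∣ A ∣ + ∣ X i ─ A ∣                  ≡⟨ cong₂ _+_ ∣A∣≡ (sym (weight-one (X i ─ A))) ⟩
          suc (t i) + weight (λ _ → 1) (X i ─ A) ≤⟨ +-monoʳ-≤ (suc (t i)) (weight-mono-≤ (X i ─ A) gain≥1) ⟩
          suc (t i) + weight gain (X i ─ A)    ≡⟨ +-suc (t i) _ ⟨
          t i + (1 + weight gain (X i ─ A))    ≤⟨ +-monoʳ-≤ (t i) (+-monoˡ-≤ _ (≤-trans 0<dA (deficit-mono (N j) {A} {A ∪ ∅} ∪ˡ))) ⟩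
          t i + (d j (A ∪ ∅) + weight gain (X i ─ A)) ≤⟨ +-monoʳ-≤ (t i) (superadditive-≥ (λ S → d j (A ∪ S)) gain step (X i ─ A)) ⟩
          t i + d j (A ∪ (X i ─ A))            ≤⟨ +-monoʳ-≤ (t i) (deficit-mono (N j) {A ∪ (X i ─ A)} (∪-lub {A = A} A⊆X (p─q⊆p (X i) A))) ⟩
          t i + d j (X i)                      ∎
          where open ≤-Reasoning

      opaque
        color-exists : ∃ (Color i)
        color-exists =
          let A , A⊆X , ∣A∣≡ = subset-of-size (X i) t<∣X∣
              2≤∣A∣ = ≤-trans (s≤s (0<t i)) (≤-reflexive (sym ∣A∣≡))
              a , a∈A = 0<∣-∣⇒nonempty A (<⇒≤ 2≤∣A∣)
              b , b∈A , b≢a = another-element {S = A} 2≤∣A∣ a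
              j , 0<dA = Σ-positive (λ j → d j A)
                (subst (0 <_) (sym (trans (Σd≡total A) (total-circuit A⊆X ∣A∣≡))) z<s)
          in j , Concentration.color A⊆X ∣A∣≡ a∈A b∈A b≢a 0<dA

    -- What a color says about points and subsets of the hyperedge.

    color-⊆ : ∀ {i j S} → Color i j → S ⊆ X i → ∣ S ∣ ≤ t i + d j S
    color-⊆ {i} {j} {S} col S⊆X = +-cancelˡ-≤ ∣ X i ─ S ∣ _ _ (begin
      ∣ X i ─ S ∣ + ∣ S ∣                  ≤⟨ ∣-─∣+∣-∣≤∣-∣ S⊆X ⟩
      ∣ X i ∣                              ≤⟨ col ⟩
      t i + d j (X i)                      ≤⟨ +-monoʳ-≤ (t i) (deficit-∪-≤ (N j) S (X i ─ S) (⊆-∪-─ S (X i))) ⟩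
      t i + (d j S + weight _ (X i ─ S))   ≤⟨ +-monoʳ-≤ (t i) (+-monoʳ-≤ (d j S) (weight-rank≤∣-∣ (N j) (X i ─ S))) ⟩
      t i + (d j S + ∣ X i ─ S ∣)          ≡⟨ +-assoc (t i) _ _ ⟨
      t i + d j S + ∣ X i ─ S ∣            ≡⟨ +-comm (t i + d j S) _ ⟩
      ∣ X i ─ S ∣ + (t i + d j S)          ∎)
      where open ≤-Reasoning

    -- The deficit of X i in N j already exhausts the total of X i, so nothing is left for the other
    -- matroids.
    color-other : ∀ {i j l S} → Color i j → l ≢ j → S ⊆ X i → d l S ≡ 0
    color-other {i} {j} {l} {S} col l≢j S⊆X = n≤0⇒n≡0 (+-cancelʳ-≤ (d j (X i)) _ _ (begin
      d l S + d j (X i)      ≤⟨ +-monoˡ-≤ _ (deficit-mono (N l) S⊆X) ⟩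
      d l (X i) + d j (X i)  ≤⟨ d+d≤total l≢j (X i) ⟩
      total (X i)            ≡⟨ total-⊆ id ⟩
      ∣ X i ∣ ∸ t i          ≤⟨ m≤n+o⇒m∸n≤o _ (t i) col ⟩
      d j (X i)              ∎))
      where open ≤-Reasoning

    color-unique : ∀ {i j l} → t i < ∣ X i ∣ → Color i j → Color i l → j ≡ l
    color-unique {i} {j} {l} t< cj cl with l Fin.≟ j
    ... | yes l≡j = sym l≡j
    ... | no  l≢j = contradiction t< (≤⇒≯ (≤-trans cl (≤-reflexive
      (trans (cong (t i +_) (color-other cj l≢j id)) (+-identityʳ _)))))

    -- If x were a loop, deleting it would not lower the deficit of X i in N j. But X i without x
    -- has one point fewer, and its total is too small for that.
    color-nonloop : ∀ {i j x} → t i < ∣ X i ∣ → Color i j → x ∈ X i → 0 < Matroid.rank (N j) ⁅ x ⁆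
    color-nonloop {i} {j} {x} t< col x∈X = n≢0⇒n>0 λ r≡0 → <-irrefl refl (begin-strict
      ∣ X i ∣                                    ≤⟨ col ⟩
      t i + d j (X i)                            ≤⟨ +-monoʳ-≤ (t i) (deficit-∪⁅⁆-≤ (N j) (X i - x) x cover) ⟩
      t i + (d j (X i - x) + Matroid.rank (N j) ⁅ x ⁆)
        ≡⟨ cong (t i +_) (trans (cong (d j (X i - x) +_) r≡0) (+-identityʳ _)) ⟩
      t i + d j (X i - x)                        ≤⟨ +-monoʳ-≤ (t i) (d≤total j (X i - x)) ⟩
      t i + total (X i - x)                      ≡⟨ cong (t i +_) (total-⊆ (p─q⊆p (X i) ⁅ x ⁆)) ⟩
      t i + (∣ X i - x ∣ ∸ t i)                  <⟨ m+[n∸m]<o t< (x∈p⇒∣p-x∣<∣p∣ x∈X) ⟩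
      ∣ X i ∣                                    ∎)
      where
      open ≤-Reasoning
      cover : X i ⊆ (X i - x) ∪ ⁅ x ⁆
      cover {y} y∈X with y Fin.≟ x
      ... | yes refl = ∪ʳ {A = X i - x} (x∈⁅x⁆ x)
      ... | no  y≢x  = ∪ˡ (x∈p∧x≢y⇒x∈p-y y∈X y≢x)

    color-rank : ∀ {i j S} → Color i j → S ⊆ X i → Matroid.rank (N j) S ≤ t i
    color-rank {i} {j} {S} col S⊆X = +-cancelʳ-≤ (d j S) _ _ (begin
      Matroid.rank (N j) S + d j S  ≡⟨ rank+deficit (N j) S ⟩
      weight _ S                    ≤⟨ weight-rank≤∣-∣ (N j) S ⟩
      ∣ S ∣                         ≤⟨ color-⊆ col S⊆X ⟩
      t i + d j S                   ∎)
      where open ≤-Reasoning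

    transversal-point : ∀ {i P b} → P ⊆ X i → b ∉ X i → ∀ l → Transversal P ⁅ b ⁆ l
    transversal-point {i} {P} {b} P⊆X b∉X l with l Fin.≟ i
    ... | yes refl = inj₂ (inj₁ λ y∈b y∈X → b∉X (subst (_∈ X i) (x∈⁅y⁆⇒x≡y b y∈b) y∈X))
    ... | no  l≢i  = inj₂ (inj₂
      ( (λ x∈P x∈X y∈P y∈X → linear l≢i x∈X (P⊆X x∈P) y∈X (P⊆X y∈P))
      , (λ x∈b _ y∈b _ → trans (x∈⁅y⁆⇒x≡y b x∈b) (sym (x∈⁅y⁆⇒x≡y b y∈b)))))

    circuit : ∀ {i j S} → Color i j → S ⊆ X i → suc (t i) ≤ ∣ S ∣ → 0 < d j S
    circuit {i} {j} {S} col S⊆X t<∣S∣ = +-cancelˡ-≤ (t i) _ _ (begin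
      t i + 1      ≡⟨ +-comm (t i) 1 ⟩
      suc (t i)    ≤⟨ t<∣S∣ ⟩
      ∣ S ∣        ≤⟨ color-⊆ col S⊆X ⟩
      t i + d j S  ∎)
      where open ≤-Reasoning

    -- Two hyperedges of the same color with a common point.

    module CommonPoint {i i′ j e} (i≢i′ : i ≢ i′)
      (t<∣X∣ : t i < ∣ X i ∣) (t<∣X∣′ : t i′ < ∣ X i′ ∣)
      (col : Color i j) (col′ : Color i′ j) (e∈X : e ∈ X i) (e∈X′ : e ∈ X i′) where

      only-e : ∀ {x} → x ∈ X i → x ∈ X i′ → x ≡ e
      only-e x∈X x∈X′ = linear i≢i′ x∈X x∈X′ e∈X e∈X′

      module Circuits {P Q} (P⊆X : P ⊆ X i) (Q⊆X : Q ⊆ X i′) (e∉P : e ∉ P) (e∉Q : e ∉ Q)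
                      (∣P∣≡t : ∣ P ∣ ≡ t i) (∣Q∣≡t : ∣ Q ∣ ≡ t i′) where

        Q∩X : ∀ {x} → x ∈ Q → x ∉ X i
        Q∩X x∈Q x∈X = e∉Q (subst (_∈ Q) (only-e x∈X (Q⊆X x∈Q)) x∈Q)

        P∩X : ∀ {x} → x ∈ P → x ∉ X i′
        P∩X x∈P x∈X = e∉P (subst (_∈ P) (only-e (P⊆X x∈P) x∈X) x∈P)

        Pe⊆X : P ∪ ⁅ e ⁆ ⊆ X i
        Pe⊆X = ∪-lub {A = P} P⊆X (⁅⁆⊆ e∈X)

        ∣Pe∣ : ∣ P ∪ ⁅ e ⁆ ∣ ≡ suc (t i)
        ∣Pe∣ = trans (∣∪⁅⁆∣ e∉P) (cong suc ∣P∣≡t)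

        0<dPe : 0 < d j (P ∪ ⁅ e ⁆)
        0<dPe = circuit col Pe⊆X (≤-reflexive (sym ∣Pe∣))

        0<dQe : 0 < d j (Q ∪ ⁅ e ⁆)
        0<dQe = circuit col′ (∪-lub {A = Q} Q⊆X (⁅⁆⊆ e∈X′))
                  (≤-reflexive (sym (trans (∣∪⁅⁆∣ e∉Q) (cong suc ∣Q∣≡t))))

        -- Circuit elimination in terms of deficits: the two circuits meet only in e, so together
        -- they have deficit at least 2, and deleting e leaves at least 1.
        0<dPQ : 0 < d j (P ∪ Q)
        0<dPQ = s≤s⁻¹ (≤-trans (+-mono-≤ 0<dPe 0<dQe) (≤-trans
          (deficit-superadditive (N j) {P ∪ ⁅ e ⁆} {Q ∪ ⁅ e ⁆} {(P ∪ Q) ∪ ⁅ e ⁆}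
            (∪-lub {A = P} (∪ˡ ∘ ∪ˡ) (∪ʳ {A = P ∪ Q})) (∪-lub {A = Q} (∪ˡ ∘ ∪ʳ {A = P}) (∪ʳ {A = P ∪ Q}))
            common (deficit-⁅⁆ (N j) e))
          (deficit-∪⁅⁆-≤1 (N j) (P ∪ Q) e id)))
          where
          common : ∀ {x} → x ∈ P ∪ ⁅ e ⁆ → x ∈ Q ∪ ⁅ e ⁆ → x ∈ ⁅ e ⁆
          common x∈Pe x∈Qe with x∈p∪q⁻ P ⁅ e ⁆ x∈Pe | x∈p∪q⁻ Q ⁅ e ⁆ x∈Qe
          ... | inj₂ x∈e | _        = x∈e
          ... | inj₁ _   | inj₂ x∈e = x∈e
          ... | inj₁ x∈P | inj₁ x∈Q = contradiction (P⊆X x∈P) (Q∩X x∈Q)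

        transversal : ∀ l → Transversal P Q l
        transversal l with l Fin.≟ i | l Fin.≟ i′
        ... | yes refl | _        = inj₂ (inj₁ Q∩X)
        ... | no _     | yes refl = inj₁ P∩X
        ... | no l≢i   | no l≢i′  = inj₂ (inj₂
          ( (λ x∈P x∈X y∈P y∈X → linear l≢i x∈X (P⊆X x∈P) y∈X (P⊆X y∈P))
          , (λ x∈Q x∈X y∈Q y∈X → linear l≢i′ x∈X (Q⊆X x∈Q) y∈X (Q⊆X y∈Q))))

        module _ {a b} (a∈P : a ∈ P) (b∈Q : b ∈ Q) (0<dab : 0 < d j (⁅ a ⁆ ∪ ⁅ b ⁆)) where
          P′ : Subset m
          P′ = (P ∪ ⁅ e ⁆) - a

          P′⊆X : P′ ⊆ X i
          P′⊆X = Pe⊆X ∘ p─q⊆p (P ∪ ⁅ e ⁆) ⁅ a ⁆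

          ∣P′∣≤t : ∣ P′ ∣ ≤ t i
          ∣P′∣≤t = s≤s⁻¹ (≤-trans (x∈p⇒∣p-x∣<∣p∣ {p = P ∪ ⁅ e ⁆} (∪ˡ a∈P)) (≤-reflexive ∣Pe∣))

          cover : (P ∪ ⁅ e ⁆) ∪ ⁅ b ⁆ ⊆ (P′ ∪ ⁅ b ⁆) ∪ ⁅ a ⁆
          cover {x} x∈ with x Fin.≟ a | x∈p∪q⁻ (P ∪ ⁅ e ⁆) ⁅ b ⁆ x∈
          ... | yes refl | _         = ∪ʳ {A = P′ ∪ ⁅ b ⁆} (x∈⁅x⁆ x)
          ... | no x≢a   | inj₁ x∈Pe = ∪ˡ (∪ˡ (x∈p∧x≢y⇒x∈p-y x∈Pe x≢a))
          ... | no _     | inj₂ x∈b  = ∪ˡ (∪ʳ {A = P′} x∈b)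

          common : ∀ {x} → x ∈ P ∪ ⁅ e ⁆ → x ∈ ⁅ a ⁆ ∪ ⁅ b ⁆ → x ∈ ⁅ a ⁆
          common x∈Pe x∈ab with x∈p∪q⁻ ⁅ a ⁆ ⁅ b ⁆ x∈ab
          ... | inj₁ x∈a = x∈a
          ... | inj₂ x∈b = contradiction (Pe⊆X x∈Pe) (Q∩X (⁅⁆⊆ b∈Q x∈b))

          -- A second elimination, this time of a from the circuits P ∪ {e} and {a, b}. It puts b
          -- into a dependent set with points of X i other than a.
          0<dP′b : 0 < d j (P′ ∪ ⁅ b ⁆)
          0<dP′b = s≤s⁻¹ (≤-trans (+-mono-≤ 0<dPe 0<dab) (≤-trans
            (deficit-superadditive (N j) {P ∪ ⁅ e ⁆} {⁅ a ⁆ ∪ ⁅ b ⁆} {(P ∪ ⁅ e ⁆) ∪ ⁅ b ⁆}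
              ∪ˡ (∪-lub {A = ⁅ a ⁆} (⁅⁆⊆ (∪ˡ (∪ˡ a∈P))) (∪ʳ {A = P ∪ ⁅ e ⁆})) common (deficit-⁅⁆ (N j) a))
            (deficit-∪⁅⁆-≤1 (N j) (P′ ∪ ⁅ b ⁆) a cover)))

          -- If tᵢ ≥ 2 then a point b ∉ Xᵢ is parallel in N j to at most one point
          -- of Xᵢ, but exchanging a for b in the circuit P ∪ {e} produces a second one.
          exchange : t i ≤ 1
          exchange =
            let a′ , b′ , a′∈P′ , b′∈b , 0<da′b′ = parallel-pair {P′} {⁅ b ⁆}
                  (transversal-point P′⊆X (Q∩X b∈Q)) (total-⊆≡0 P′⊆X ∣P′∣≤t) (total-⁅⁆ b) 0<dP′b
                a≢a′ : a ≢ a′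
                a≢a′ = λ a≡a′ → x∉p-x (P ∪ ⁅ e ⁆) a (subst (_∈ P′) (sym a≡a′) a′∈P′)
                0<dba′ = subst (λ S → 0 < d j S) (trans (cong (⁅ a′ ⁆ ∪_) (cong ⁅_⁆ (x∈⁅y⁆⇒x≡y b b′∈b))) (∪-comm ⁅ a′ ⁆ ⁅ b ⁆)) 0<da′b′
                -- Two points of X i parallel to b are parallel to each other, whereas for `t i` at
                -- least 2 a pair inside X i has total 0.
                0<daa′ = parallel-trans (N j) a≢a′ 0<dab 0<dba′
            in ≮⇒≥ λ 1<t → <-irrefl (sym (total≡0⇒d≡0
                 (total-⊆≡0 (∪-lub {A = ⁅ a ⁆} (⁅⁆⊆ (P⊆X a∈P)) (⁅⁆⊆ (P′⊆X a′∈P′))) (≤-trans (∣pair∣≤2 a a′) 1<t)) j)) 0<daa′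

        t≤1 : t i ≤ 1
        t≤1 =
          let a , b , a∈P , b∈Q , 0<dab = parallel-pair {P} {Q} transversal
                (total-⊆≡0 P⊆X (≤-reflexive ∣P∣≡t)) (total-⊆≡0 Q⊆X (≤-reflexive ∣Q∣≡t)) 0<dPQ
          in exchange a∈P b∈Q 0<dab

      t≤1 : t i ≤ 1
      t≤1 =
        let P , P⊆ , ∣P∣≡t = base t<∣X∣
            Q , Q⊆ , ∣Q∣≡t = base t<∣X∣′
        in Circuits.t≤1 (p─q⊆p (X i) ⁅ e ⁆ ∘ P⊆) (p─q⊆p (X i′) ⁅ e ⁆ ∘ Q⊆)
             (x∉p-x (X i) e ∘ P⊆) (x∉p-x (X i′) e ∘ Q⊆) ∣P∣≡t ∣Q∣≡t
        where
        base : ∀ {i} → t i < ∣ X i ∣ → ∃ λ P → P ⊆ X i - e × ∣ P ∣ ≡ t i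
        base {i} t< = subset-of-size (X i - e) (s≤s⁻¹ (≤-trans t< (∣-∣≤1+∣-─⁅⁆∣ (X i) e)))

    -- Parallel pairs on hyperedges with t = 1.

    module _ {i j} (t≡1 : t i ≡ 1) (col : Color i j) where

      line-pair : ∀ {p q} → p ≢ q → p ∈ X i → q ∈ X i → 0 < d j (⁅ p ⁆ ∪ ⁅ q ⁆)
      line-pair {p} {q} p≢q p∈X q∈X = circuit col (∪-lub {A = ⁅ p ⁆} (⁅⁆⊆ p∈X) (⁅⁆⊆ q∈X))
        (≤-reflexive (trans (cong suc t≡1) (sym (∣pair∣≡2 p≢q))))

    total-pair≤1 : ∀ {a b} → 0 < total (⁅ a ⁆ ∪ ⁅ b ⁆) → total (⁅ a ⁆ ∪ ⁅ b ⁆) ≤ 1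
    total-pair≤1 {a} {b} 0<total with l , t≡1 , a∈X , b∈X ← line-through 0<total = begin
      total (⁅ a ⁆ ∪ ⁅ b ⁆)      ≡⟨ total-⊆ (∪-lub {A = ⁅ a ⁆} (⁅⁆⊆ a∈X) (⁅⁆⊆ b∈X)) ⟩
      ∣ ⁅ a ⁆ ∪ ⁅ b ⁆ ∣ ∸ t l    ≤⟨ ∸-mono (∣pair∣≤2 a b) (≤-reflexive (sym t≡1)) ⟩
      1                          ∎
      where open ≤-Reasoning

    parallel⇒total≤1 : ∀ {j a b} → 0 < d j (⁅ a ⁆ ∪ ⁅ b ⁆) → total (⁅ a ⁆ ∪ ⁅ b ⁆) ≤ 1
    parallel⇒total≤1 {j} 0<d = total-pair≤1 (≤-trans 0<d (d≤total j _))

    0<excess : ∀ {l x y A} → t l ≡ 1 → x ≢ y → x ∈ A → x ∈ X l → y ∈ A → y ∈ X l → 0 < excess l A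
    0<excess {l} {x} {y} {A} t≡1 x≢y x∈A x∈X y∈A y∈X = subst (0 <_) (sym (excess-def l A)) (m<n⇒0<n∸m (begin
      suc (t l)            ≡⟨ trans (cong suc t≡1) (sym (∣pair∣≡2 x≢y)) ⟩
      ∣ ⁅ x ⁆ ∪ ⁅ y ⁆ ∣    ≤⟨ p⊆q⇒∣p∣≤∣q∣ (∪-lub {A = ⁅ x ⁆} (⁅⁆⊆ (x∈p∩q⁺ (x∈A , x∈X))) (⁅⁆⊆ (x∈p∩q⁺ (y∈A , y∈X)))) ⟩
      ∣ A ∩ X l ∣          ∎))
      where open ≤-Reasoning

    -- In N j the points e, a, x of X i are all parallel, and then so is b. Hence b is joined to
    -- each of them by a hyperedge with t = 1, and the resulting excesses are too many for the four
    -- points.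
    module FourPoints {i j e a x b} (t≡1 : t i ≡ 1) (col : Color i j)
      (e≢a : e ≢ a) (e≢x : e ≢ x) (a≢x : a ≢ x) (e∈X : e ∈ X i) (a∈X : a ∈ X i) (x∈X : x ∈ X i)
      (b∉X : b ∉ X i) (0<deb : 0 < d j (⁅ e ⁆ ∪ ⁅ b ⁆)) where

      ∈≢b : ∀ {p} → p ∈ X i → p ≢ b
      ∈≢b p∈X p≡b = b∉X (subst (_∈ X i) p≡b p∈X)

      0<dpb : ∀ {p} → p ∈ X i → 0 < d j (⁅ p ⁆ ∪ ⁅ b ⁆)
      0<dpb {p} p∈X with p Fin.≟ e
      ... | yes refl = 0<deb
      ... | no p≢e   = parallel-trans (N j) (∈≢b p∈X) (line-pair t≡1 col p≢e p∈X e∈X) 0<deb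

      -- The total of {p, b} is at most 1 and N j uses it up. In the other matroids two triples
      -- through p and b may therefore be combined superadditively.
      other≡0 : ∀ {l p} → l ≢ j → p ∈ X i → d l (⁅ p ⁆ ∪ ⁅ b ⁆) ≡ 0
      other≡0 {l} {p} l≢j p∈X = n≤0⇒n≡0 (+-cancelʳ-≤ 1 _ _ (begin
        d l (⁅ p ⁆ ∪ ⁅ b ⁆) + 1                        ≤⟨ +-monoʳ-≤ (d l (⁅ p ⁆ ∪ ⁅ b ⁆)) (0<dpb p∈X) ⟩
        d l (⁅ p ⁆ ∪ ⁅ b ⁆) + d j (⁅ p ⁆ ∪ ⁅ b ⁆)      ≤⟨ d+d≤total l≢j _ ⟩
        total (⁅ p ⁆ ∪ ⁅ b ⁆)                          ≤⟨ parallel⇒total≤1 (0<dpb p∈X) ⟩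
        1                                              ∎))
        where open ≤-Reasoning

      T : Fin m → Fin m → Subset m
      T p q = (⁅ p ⁆ ∪ ⁅ q ⁆) ∪ ⁅ b ⁆

      p∈T : ∀ {p q} → p ∈ T p q
      p∈T {p} = ∪ˡ (∪ˡ (x∈⁅x⁆ p))

      q∈T : ∀ {p q} → q ∈ T p q
      q∈T {p} {q} = ∪ˡ (∪ʳ {A = ⁅ p ⁆} (x∈⁅x⁆ q))

      b∈T : ∀ {p q} → b ∈ T p q
      b∈T {p} {q} = ∪ʳ {A = ⁅ p ⁆ ∪ ⁅ q ⁆} (x∈⁅x⁆ b)

      -- One unit comes from each of X i and the hyperedges X u through p, b and X v through q, b.
      -- They are distinct: b is not on X i, and if u and v agreed, X u would share both p and q
      -- with X i.
      3≤totalT : ∀ {p q} → p ≢ q → p ∈ X i → q ∈ X i → 3 ≤ total (T p q)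
      3≤totalT {p} {q} p≢q p∈X q∈X
        with u , tu , p∈u , b∈u ← line-through (≤-trans (0<dpb p∈X) (d≤total j _))
           | v , tv , q∈v , b∈v ← line-through (≤-trans (0<dpb q∈X) (d≤total j _)) = ≤-trans
        (+-mono-≤ (0<excess {A = T p q} t≡1 p≢q p∈T p∈X q∈T q∈X)
          (+-mono-≤ (0<excess {A = T p q} tu (∈≢b p∈X) p∈T p∈u b∈T b∈u)
                    (0<excess {A = T p q} tv (∈≢b q∈X) q∈T q∈v b∈T b∈v)))
        (three-terms≤Σ (λ l → excess l (T p q))
          (λ i≡u → b∉X (subst (λ l → b ∈ X l) (sym i≡u) b∈u))
          (λ i≡v → b∉X (subst (λ l → b ∈ X l) (sym i≡v) b∈v))
          (λ u≡v → p≢q (linear (λ i≡u → b∉X (subst (λ l → b ∈ X l) (sym i≡u) b∈u))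
                          p∈X p∈u q∈X (subst (λ l → q ∈ X l) (sym u≡v) q∈v))))

      L F : Subset m
      L = (⁅ e ⁆ ∪ ⁅ a ⁆) ∪ ⁅ x ⁆
      F = L ∪ ⁅ b ⁆

      L⊆X : L ⊆ X i
      L⊆X = ∪-lub {A = ⁅ e ⁆ ∪ ⁅ a ⁆} (∪-lub {A = ⁅ e ⁆} (⁅⁆⊆ e∈X) (⁅⁆⊆ a∈X)) (⁅⁆⊆ x∈X)

      ∣L∣≡3 : ∣ L ∣ ≡ 3
      ∣L∣≡3 = trans (∣∪⁅⁆∣ λ x∈ → [ e≢x ∘ sym ∘ x∈⁅y⁆⇒x≡y e , a≢x ∘ sym ∘ x∈⁅y⁆⇒x≡y a ]′ (x∈p∪q⁻ ⁅ e ⁆ ⁅ a ⁆ x∈))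
                    (cong suc (∣pair∣≡2 e≢a))

      e∈F : e ∈ F
      e∈F = ∪ˡ (∪ˡ (∪ˡ (x∈⁅x⁆ e)))

      a∈F : a ∈ F
      a∈F = ∪ˡ (∪ˡ (∪ʳ {A = ⁅ e ⁆} (x∈⁅x⁆ a)))

      x∈F : x ∈ F
      x∈F = ∪ˡ (∪ʳ {A = ⁅ e ⁆ ∪ ⁅ a ⁆} (x∈⁅x⁆ x))

      T⊆F : ∀ {p q} → p ∈ F → q ∈ F → T p q ⊆ F
      T⊆F {p} {q} p∈F q∈F = ∪-lub {A = ⁅ p ⁆ ∪ ⁅ q ⁆} (∪-lub {A = ⁅ p ⁆} (⁅⁆⊆ p∈F) (⁅⁆⊆ q∈F)) (∪ʳ {A = L})

      total-F≤5 : total F ≤ 5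
      total-F≤5 = begin
        total F                                    ≤⟨ total-∪ {L} {⁅ b ⁆} (transversal-point L⊆X b∉X) ⟩
        total L + total ⁅ b ⁆ + pairs total L ⁅ b ⁆ ≡⟨ cong₂ (λ u v → total L + u + v) (total-⁅⁆ b) (weight-⁅⁆ _ b) ⟩
        total L + 0 + weight (λ p → total (⁅ p ⁆ ∪ ⁅ b ⁆)) L
          -- The three points of L exceed `t i` = 1 by 2, and each of the three pairs formed with b
          -- has total at most 1.
          ≤⟨ +-mono-≤ (≤-reflexive (trans (+-identityʳ _) (trans (total-⊆ L⊆X) (cong₂ _∸_ ∣L∣≡3 t≡1))))
               (weight-mono-≤ L λ p∈L → parallel⇒total≤1 (0<dpb (L⊆X p∈L))) ⟩
        2 + weight (λ _ → 1) L                     ≡⟨ cong (2 +_) (trans (weight-one L) ∣L∣≡3) ⟩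
        5                                          ∎
        where open ≤-Reasoning

      share : ∀ l {p q r A B} → l ≢ j → p ∈ X i → q ≢ r → A ⊆ F → B ⊆ F →
              A ⊆ (⁅ p ⁆ ∪ ⁅ b ⁆) ∪ ⁅ q ⁆ → B ⊆ (⁅ p ⁆ ∪ ⁅ b ⁆) ∪ ⁅ r ⁆ → d l A + d l B ≤ d l F
      share l {A = A} {B} l≢j p∈X q≢r A⊆F B⊆F A⊆ B⊆ =
        deficit-superadditive (N l) {A} {B} A⊆F B⊆F (∩-⊆-common {A = A} {B} q≢r A⊆ B⊆) (other≡0 l≢j p∈X)

      Tˡ : ∀ {p q} → T p q ⊆ (⁅ p ⁆ ∪ ⁅ b ⁆) ∪ ⁅ q ⁆
      Tˡ {p} {q} = ∪-lub {A = ⁅ p ⁆ ∪ ⁅ q ⁆} (∪-lub {A = ⁅ p ⁆} (∪ˡ ∘ ∪ˡ) (∪ʳ {A = ⁅ p ⁆ ∪ ⁅ b ⁆})) (∪ˡ ∘ ∪ʳ {A = ⁅ p ⁆})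

      Tʳ : ∀ {p q} → T q p ⊆ (⁅ p ⁆ ∪ ⁅ b ⁆) ∪ ⁅ q ⁆
      Tʳ {p} {q} = ∪-lub {A = ⁅ q ⁆ ∪ ⁅ p ⁆} (∪-lub {A = ⁅ q ⁆} (∪ʳ {A = ⁅ p ⁆ ∪ ⁅ b ⁆}) (∪ˡ ∘ ∪ˡ)) (∪ˡ ∘ ∪ʳ {A = ⁅ p ⁆})

      three-circuits : Fin k → ℕ
      three-circuits l = d l (T e a) + d l (T e x) + d l (T a x)

      -- Outside N j the set L has deficit 0, so F has deficit at most 1, and any two of the triples
      -- share a pair of deficit 0. Thus at most one triple has positive deficit in N l.
      elsewhere : ∀ l → l ≢ j → three-circuits l ≤ d l F
      elsewhere l l≢j = three≤one (d l (T e a)) (d l (T e x)) (d l (T a x))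
        (share l l≢j e∈X a≢x (T⊆F e∈F a∈F) (T⊆F e∈F x∈F) Tˡ Tˡ)
        (share l l≢j a∈X e≢x (T⊆F e∈F a∈F) (T⊆F a∈F x∈F) Tʳ Tˡ)
        (share l l≢j x∈X e≢a (T⊆F e∈F x∈F) (T⊆F a∈F x∈F) Tʳ Tʳ)
        (≤-trans (deficit-∪⁅⁆-≤1 (N l) L b id) (≤-reflexive (cong suc (color-other col l≢j L⊆X))))

      dT≤2 : ∀ {p q} → p ≢ q → p ∈ X i → q ∈ X i → d j (T p q) ≤ 2
      dT≤2 {p} {q} p≢q p∈X q∈X = ≤-trans (deficit-∪⁅⁆-≤1 (N j) (⁅ p ⁆ ∪ ⁅ q ⁆) b id)
        (s≤s (≤-trans (d≤total j _) (parallel⇒total≤1 (line-pair t≡1 col p≢q p∈X q∈X))))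

      2≤dL : 2 ≤ d j L
      2≤dL = s≤s⁻¹ (≤-trans (≤-reflexive (sym ∣L∣≡3)) (≤-trans (color-⊆ col L⊆X) (≤-reflexive (cong (_+ d j L) t≡1))))

      3≤dF : 3 ≤ d j F
      3≤dF = ≤-trans (+-mono-≤ 2≤dL 0<deb)
        (deficit-superadditive (N j) {L} {⁅ e ⁆ ∪ ⁅ b ⁆} {F} ∪ˡ (∪-lub {A = ⁅ e ⁆} (⁅⁆⊆ e∈F) (∪ʳ {A = L}))
          (λ y∈L y∈eb → [ id , (λ y∈b → contradiction (L⊆X y∈L) (λ y∈X → ∈≢b y∈X (x∈⁅y⁆⇒x≡y b y∈b))) ]′
                          (x∈p∪q⁻ ⁅ e ⁆ ⁅ b ⁆ y∈eb))
          (deficit-⁅⁆ (N j) e))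

      -- Each triple has deficit at most 2 in N j, which gives 6, while F has at least 3 there. The
      -- difference is the slack 3 added to `total F`.
      here-bound : three-circuits j ≤ d j F + 3
      here-bound = ≤-trans (+-mono-≤ (+-mono-≤ (dT≤2 e≢a e∈X a∈X) (dT≤2 e≢x e∈X x∈X)) (dT≤2 a≢x a∈X x∈X))
                           (+-monoˡ-≤ 3 3≤dF)

      -- The triples eab, exb, axb have total deficit 3 each, and the four points
      -- have total deficit at most 5, of which N j already accounts for 3.
      9≤8 : 9 ≤ 8
      9≤8 = begin
        9                                                   ≤⟨ +-mono-≤ (+-mono-≤ (3≤totalT e≢a e∈X a∈X) (3≤totalT e≢x e∈X x∈X)) (3≤totalT a≢x a∈X x∈X) ⟩
        total (T e a) + total (T e x) + total (T a x)       ≡⟨ cong₂ _+_ (cong₂ _+_ (Σd≡total (T e a)) (Σd≡total (T e x))) (Σd≡total (T a x)) ⟨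
        _                                                   ≡⟨ Σ-distrib-+₃ (λ l → d l (T e a)) (λ l → d l (T e x)) (λ l → d l (T a x)) ⟨
        Σ[ three-circuits ]                                 ≤⟨ Σ-mono-≤-except j elsewhere here-bound ⟩
        Σ[ (λ l → d l F) ] + 3                              ≡⟨ cong (_+ 3) (Σd≡total F) ⟩
        total F + 3                                         ≤⟨ +-monoˡ-≤ 3 total-F≤5 ⟩
        8                                                   ∎
        where open ≤-Reasoning

    -- A further point x of X i would make p, q, x together with r the four points ruled out by
    -- `FourPoints`.
    two-point-line : ∀ {i j p q r} → t i ≡ 1 → Color i j → p ≢ q → p ∈ X i → q ∈ X i →
      r ∉ X i → 0 < d j (⁅ p ⁆ ∪ ⁅ r ⁆) → X i ≡ ⁅ p ⁆ ∪ ⁅ q ⁆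
    two-point-line {i} {j} {p} {q} {r} t≡1 col p≢q p∈X q∈X r∉X 0<d =
      ⊆-antisym X⊆ (∪-lub {A = ⁅ p ⁆} (⁅⁆⊆ p∈X) (⁅⁆⊆ q∈X))
      where
      X⊆ : X i ⊆ ⁅ p ⁆ ∪ ⁅ q ⁆
      X⊆ {x} x∈X with p Fin.≟ x | q Fin.≟ x
      ... | yes refl | _        = ∪ˡ (x∈⁅x⁆ p)
      ... | no _     | yes refl = ∪ʳ {A = ⁅ p ⁆} (x∈⁅x⁆ q)
      ... | no p≢x   | no q≢x   =
        contradiction (FourPoints.9≤8 t≡1 col p≢q p≢x q≢x p∈X q∈X x∈X r∉X 0<d) (<-irrefl refl)

    pair-color-unique : ∀ {l i j a b} → t i ≡ 1 → Color i l → a ≢ b → a ∈ X i → b ∈ X i →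
                        0 < d j (⁅ a ⁆ ∪ ⁅ b ⁆) → l ≡ j
    pair-color-unique {l} {i} {j} {a} {b} t≡1 col a≢b a∈X b∈X 0<dab with l Fin.≟ j
    ... | yes l≡j = l≡j
    ... | no  l≢j = contradiction (≤-trans (+-mono-≤ (line-pair t≡1 col a≢b a∈X b∈X) 0<dab)
      (≤-trans (d+d≤total l≢j (⁅ a ⁆ ∪ ⁅ b ⁆)) (parallel⇒total≤1 {j} 0<dab))) λ where (s≤s ())

    -- X i has some color l, in whose matroid a and b are parallel as well. The pair has total at
    -- most 1, so l is j.
    pair-color : ∀ {i j a b} → t i ≡ 1 → a ≢ b → a ∈ X i → b ∈ X i →
                 0 < d j (⁅ a ⁆ ∪ ⁅ b ⁆) → Color i j
    pair-color {i} {j} {a} {b} t≡1 a≢b a∈X b∈X 0<dab =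
      let _ , col = color-exists (≤-trans (≤-reflexive (trans (cong suc t≡1) (sym (∣pair∣≡2 a≢b))))
                      (p⊆q⇒∣p∣≤∣q∣ (∪-lub {A = ⁅ a ⁆} (⁅⁆⊆ a∈X) (⁅⁆⊆ b∈X))))
      in subst (Color i) (pair-color-unique t≡1 col a≢b a∈X b∈X 0<dab) col

    -- Hyperedges of the same color are disjoint.

    module _ (noTriangle : ∀ {a b c i j l} → a ≢ b → a ≢ c → b ≢ c →
      X i ≡ ⁅ a ⁆ ∪ ⁅ b ⁆ → X j ≡ ⁅ a ⁆ ∪ ⁅ c ⁆ → X l ≢ ⁅ b ⁆ ∪ ⁅ c ⁆) where

      module _ {i i′ j e a b} (i≢i′ : i ≢ i′) (t≡1 : t i ≡ 1) (t≡1′ : t i′ ≡ 1)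
        (col : Color i j) (col′ : Color i′ j) (e∈X : e ∈ X i) (e∈X′ : e ∈ X i′)
        (a∈X : a ∈ X i) (b∈X′ : b ∈ X i′) (a≢e : a ≢ e) (b≢e : b ≢ e) where

        private
          a∉X′ : a ∉ X i′
          a∉X′ a∈X′ = a≢e (linear i≢i′ a∈X a∈X′ e∈X e∈X′)

          b∉X : b ∉ X i
          b∉X b∈X = b≢e (linear i≢i′ b∈X b∈X′ e∈X e∈X′)

          a≢b : a ≢ b
          a≢b a≡b = b∉X (subst (_∈ X i) a≡b a∈X)

          0<dae : 0 < d j (⁅ a ⁆ ∪ ⁅ e ⁆)
          0<dae = line-pair t≡1 col a≢e a∈X e∈X

          0<deb : 0 < d j (⁅ e ⁆ ∪ ⁅ b ⁆)
          0<deb = line-pair t≡1′ col′ (b≢e ∘ sym) e∈X′ b∈X′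

          0<dab : 0 < d j (⁅ a ⁆ ∪ ⁅ b ⁆)
          0<dab = parallel-trans (N j) a≢b 0<dae 0<deb

          third-line : ∀ {l} → t l ≡ 1 → a ∈ X l → b ∈ X l → X l ≡ ⁅ a ⁆ ∪ ⁅ b ⁆
          third-line {l} tl a∈l b∈l =
            two-point-line tl (pair-color tl a≢b a∈l b∈l 0<dab) a≢b a∈l b∈l e∉l 0<dae
            where
            i≢l : i ≢ l
            i≢l i≡l = b∉X (subst (λ u → b ∈ X u) (sym i≡l) b∈l)
            e∉l : e ∉ X l
            e∉l e∈l = a≢e (linear i≢l a∈X a∈l e∈X e∈l)

        -- In N j both a and b are parallel to e, hence to each other, and this forces a third
        -- hyperedge through a and b, again with t = 1 and color j. For each of the three, the
        -- remaining one of a, b, e lies off it and is parallel to a point on it, so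
        -- `two-point-line` applies to all three.
        triangle : ∃ λ l → X i ≡ ⁅ e ⁆ ∪ ⁅ a ⁆ × X i′ ≡ ⁅ e ⁆ ∪ ⁅ b ⁆ × X l ≡ ⁅ a ⁆ ∪ ⁅ b ⁆
        triangle =
          let l , tl , a∈l , b∈l = line-through (≤-trans 0<dab (d≤total j (⁅ a ⁆ ∪ ⁅ b ⁆)))
          in l , two-point-line t≡1 col (a≢e ∘ sym) e∈X a∈X b∉X 0<deb
               , two-point-line t≡1′ col′ (b≢e ∘ sym) e∈X′ b∈X′ a∉X′ (line-pair t≡1 col (a≢e ∘ sym) e∈X a∈X)
               , third-line tl a∈l b∈l

        no-common-point : ⊥
        no-common-point = let _ , Xi≡ , Xi′≡ , Xl≡ = triangle in
          noTriangle (a≢e ∘ sym) (b≢e ∘ sym) a≢b Xi≡ Xi′≡ Xl≡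

      color-proper : ∀ {i i′ j e} → i ≢ i′ → t i < ∣ X i ∣ → t i′ < ∣ X i′ ∣ →
                     Color i j → Color i′ j → e ∈ X i → e ∉ X i′
      color-proper {i} {i′} {j} {e} i≢i′ t< t<′ col col′ e∈X e∈X′ =
        let a , a∈X , a≢e = another-element {S = X i} (≤-trans (s≤s (0<t i)) t<) e
            b , b∈X′ , b≢e = another-element {S = X i′} (≤-trans (s≤s (0<t i′)) t<′) e
        in no-common-point i≢i′
             (≤-antisym (CommonPoint.t≤1 i≢i′ t< t<′ col col′ e∈X e∈X′) (0<t i))
             (≤-antisym (CommonPoint.t≤1 (i≢i′ ∘ sym) t<′ t< col′ col e∈X′ e∈X) (0<t i′))
             col col′ e∈X e∈X′ a∈X b∈X′ a≢e b≢e

  -- The decomposition given by a coloring.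

  U : Fin n → Matroid m
  U i = uniform⊕loops (X i) (t i)

  0<rank-U : ∀ {i x} → x ∈ X i → 0 < Matroid.rank (U i) ⁅ x ⁆
  0<rank-U {i} {x} x∈X = ⊓-glb (nonempty⇒0<∣-∣ (x∈p∩q⁺ (x∈⁅x⁆ x , x∈X))) (0<t i)

  0<rank-U⇒∈ : ∀ {i x} → 0 < Matroid.rank (U i) ⁅ x ⁆ → x ∈ X i
  0<rank-U⇒∈ {i} {x} 0<r with y , y∈ ← 0<∣-∣⇒nonempty (⁅ x ⁆ ∩ X i) (≤-trans 0<r (m⊓n≤m _ (t i))) =
    let y∈x , y∈X = x∈p∩q⁻ ⁅ x ⁆ (X i) y∈ in subst (_∈ X i) (x∈⁅y⁆⇒x≡y x y∈x) y∈X

  Separating : (Fin n → Fin k) → Set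
  Separating c = ∀ {i j x} → i ≢ j → x ∈ X i → x ∈ X j → c i ≢ c j

  module _ {k} (c : Fin n → Fin k) (separating : Separating c) where

    component : Fin k → Fin n → Matroid m
    component j i = when (c i Fin.≟ j) (U i)

    component-point : ∀ {j i x} → 0 < Matroid.rank (component j i) ⁅ x ⁆ → c i ≡ j × x ∈ X i
    component-point {j} {i} 0<r with c i Fin.≟ j
    ... | yes ci≡j = ci≡j , 0<rank-U⇒∈ 0<r

    colorClass : Fin k → Matroid m
    colorClass j = sumMatroid (component j) λ x → Σ-at-most-one _ (λ i → rank-⁅⁆≤1 (component j i) x)
      λ {i} {i′} 0<r 0<r′ → case i Fin.≟ i′ of λ where
        (yes i≡i′) → i≡i′
        (no  i≢i′) → let ci≡j , x∈X = component-point 0<r; ci′≡j , x∈X′ = component-point 0<r′ in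
          contradiction (trans ci≡j (sym ci′≡j)) (separating i≢i′ x∈X x∈X′)

    rank-own-component : ∀ i A → Matroid.rank (component (c i) i) A ≡ Matroid.rank (U i) A
    rank-own-component i A = rank-when-yes (c i Fin.≟ c i) refl A

    colorClass-point : ∀ {j x} → 0 < Matroid.rank (colorClass j) ⁅ x ⁆ → ∃ λ i → c i ≡ j × x ∈ X i
    colorClass-point {j} 0<r with i , 0<rᵢ ← Σ-positive _ 0<r = i , component-point 0<rᵢ

    point-colorClass : ∀ {i x} → x ∈ X i → 0 < Matroid.rank (colorClass (c i)) ⁅ x ⁆
    point-colorClass {i} {x} x∈X = ≤-trans (0<rank-U x∈X) (≤-trans
      (≤-reflexive (sym (rank-own-component i ⁅ x ⁆)))
      (term≤Σ (λ l → Matroid.rank (component (c i) l) ⁅ x ⁆) i))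

    Σ-colorClass : ∀ A → Σ[ (λ i → ∣ A ∩ X i ∣ ⊓ t i) ] ≡ Σ[ (λ j → Matroid.rank (colorClass j) A) ]
    Σ-colorClass A = begin
      Σ[ (λ i → Matroid.rank (U i) A) ]                               ≡⟨ Σ-cong (λ i → rank-own-component i A) ⟨
      Σ[ (λ i → Matroid.rank (component (c i) i) A) ]
        ≡⟨ Σ-cong (λ i → Σ-single (λ j → Matroid.rank (component j i) A) (c i)
             λ j j≢ci → rank-when-no (c i Fin.≟ j) (j≢ci ∘ sym) A) ⟨
      Σ[ (λ i → Σ[ (λ j → Matroid.rank (component j i) A) ]) ]        ≡⟨ Σ-comm (λ i j → Matroid.rank (component j i) A) ⟩
      Σ[ (λ j → Matroid.rank (colorClass j) A) ]                      ∎
      where open ≡-Reasoning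

    open Decomposition colorClass Σ-colorClass

    -- The summand U i of the class `c i` already has the full deficit on X i. Reading a color back
    -- from the deficits therefore returns `c i`, and this is injectivity on hyperedges with t <
    -- |X|.
    colorClass-color : ∀ i → Color i (c i)
    colorClass-color i = begin
      ∣ X i ∣                                             ≤⟨ m≤n+m∸n ∣ X i ∣ (t i) ⟩
      t i + (∣ X i ∣ ∸ t i)                               ≡⟨ cong (λ S → t i + (∣ S ∣ ∸ t i)) (∩-idem (X i)) ⟨
      t i + (∣ X i ∩ X i ∣ ∸ t i)                         ≡⟨ cong (t i +_) (deficit-uniform⊕loops (X i) (0<t i) (X i)) ⟨
      t i + deficit (U i) (X i)                           ≡⟨ cong (t i +_) (deficit-cong _ _ (rank-own-component i) (X i)) ⟨
      t i + deficit (component (c i) i) (X i)             ≤⟨ +-monoʳ-≤ (t i) (term≤Σ (λ l → deficit (component (c i) l) (X i)) i) ⟩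
      t i + Σ[ (λ l → deficit (component (c i) l) (X i)) ] ≡⟨ cong (t i +_) (deficit-sumMatroid (component (c i)) _ (X i)) ⟩
      t i + d (c i) (X i)                                 ∎
      where open ≤-Reasoning

  -- Injectivity.

  module _ (large⊎singleton : ∀ i → t i < ∣ X i ∣ ⊎ ∃ λ e → X i ≡ ⁅ e ⁆)
           (X-injective : ∀ {i j} → X i ≡ X j → i ≡ j) where

    colorClass-injective-large : ∀ {k} {c c′ : Fin n → Fin k} (sep : Separating c) (sep′ : Separating c′) →
      (∀ j A → Matroid.rank (colorClass c sep j) A ≡ Matroid.rank (colorClass c′ sep′ j) A) →
      ∀ {i} → t i < ∣ X i ∣ → c i ≡ c′ i
    colorClass-injective-large {c = c} {c′} sep sep′ same {i} t< =
      color-unique t< (colorClass-color c sep i) (≤-trans (colorClass-color c′ sep′ i) (≤-reflexive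
        (cong (t i +_) (sym (deficit-cong (colorClass c sep (c′ i)) (colorClass c′ sep′ (c′ i)) (same (c′ i)) (X i))))))
      where open Decomposition (colorClass c sep) (Σ-colorClass c sep)

    same-point : ∀ {i i′ e e′} → X i ≡ ⁅ e ⁆ → X i′ ≡ ⁅ e′ ⁆ → ∀ {x} → x ∈ X i → x ∈ X i′ → i ≡ i′
    same-point {e = e} {e′} X≡e X′≡e′ x∈X x∈X′ = X-injective (trans X≡e (trans
      (cong ⁅_⁆ (trans (sym (x∈⁅y⁆⇒x≡y e (subst (_ ∈_) X≡e x∈X))) (x∈⁅y⁆⇒x≡y e′ (subst (_ ∈_) X′≡e′ x∈X′))))
      (sym X′≡e′)))

    -- For a one-point hyperedge {e}, the class of color `c i` has e as a non-loop, so `c′` gives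
    -- this color to some X l through e. If X l is large, then `c` and `c′` agree on l, and for l
    -- other than i the coloring `c` would give two hyperedges through e the same color.
    colorClass-injective : ∀ {k} {c c′ : Fin n → Fin k} (sep : Separating c) (sep′ : Separating c′) →
      (∀ j A → Matroid.rank (colorClass c sep j) A ≡ Matroid.rank (colorClass c′ sep′ j) A) →
      ∀ i → c i ≡ c′ i
    colorClass-injective {c = c} {c′} sep sep′ same i with large⊎singleton i
    ... | inj₁ t< = colorClass-injective-large sep sep′ same t<
    ... | inj₂ (e , X≡e) = from-point
      (colorClass-point c′ sep′ (subst (0 <_) (same (c i) ⁅ e ⁆) (point-colorClass c sep e∈X)))
      where
      e∈X : e ∈ X i
      e∈X = subst (e ∈_) (sym X≡e) (x∈⁅x⁆ e)

      from-point : (∃ λ l → c′ l ≡ c i × e ∈ X l) → c i ≡ c′ i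
      from-point (l , c′l≡ci , e∈l) with large⊎singleton l
      ... | inj₂ (_ , Xl≡) = trans (sym c′l≡ci) (cong c′ (same-point Xl≡ X≡e e∈l e∈X))
      ... | inj₁ t<l with l Fin.≟ i
      ...   | yes refl = sym c′l≡ci
      ...   | no l≢i   = contradiction (trans (colorClass-injective-large sep sep′ same t<l) c′l≡ci)
                                       (sep l≢i e∈l e∈X)

    -- Surjectivity.

    module Surjectivity (noTriangle : ∀ {a b c i j l} → a ≢ b → a ≢ c → b ≢ c →
        X i ≡ ⁅ a ⁆ ∪ ⁅ b ⁆ → X j ≡ ⁅ a ⁆ ∪ ⁅ c ⁆ → X l ≢ ⁅ b ⁆ ∪ ⁅ c ⁆)
      {k : ℕ} (N : Fin k → Matroid m)
      (decomposes : ∀ A → Σ[ (λ i → ∣ A ∩ X i ∣ ⊓ t i) ] ≡ Σ[ (λ j → Matroid.rank (N j) A) ]) where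

      open Decomposition N decomposes

      -- The common interface of the two kinds of hyperedge: `nonloop` and `rank≤t` serve the
      -- comparison of N j with its color class, while `large` and `fresh` make the coloring
      -- separating.
      record Admissible (i : Fin n) (j : Fin k) : Set where
        field
          nonloop : ∀ {x} → x ∈ X i → 0 < Matroid.rank (N j) ⁅ x ⁆
          rank≤t  : ∀ {S} → S ⊆ X i → Matroid.rank (N j) S ≤ t i
          large   : t i < ∣ X i ∣ → Color i j
          fresh   : ∀ {e} → X i ≡ ⁅ e ⁆ → ∀ {l} → t l < ∣ X l ∣ → e ∈ X l → ¬ Color l j

      ∣singleton∣≤t : ∀ {i e} → X i ≡ ⁅ e ⁆ → ∣ X i ∣ ≤ t i
      ∣singleton∣≤t {i} {e} X≡e = ≤-trans (≤-reflexive (trans (cong ∣_∣ X≡e) (∣⁅x⁆∣≡1 e))) (0<t i)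

      -- Colors for one-point hyperedges.

      module _ (e : Fin m) where

        Occupied : Fin n → Fin k → Set
        Occupied l j = e ∈ X l × t l < ∣ X l ∣ × Color l j

        occupied? : ∀ l j → Dec (Occupied l j)
        occupied? l j = (e ∈? X l) ×-dec ((t l <? ∣ X l ∣) ×-dec (∣ X l ∣ ≤? t l + d j (X l)))

        indicator : ∀ {P : Set} → Dec P → ℕ
        indicator (yes _) = 1
        indicator (no  _) = 0

        0<indicator⇒ : ∀ {P : Set} (P? : Dec P) → 0 < indicator P? → P
        0<indicator⇒ (yes p) _ = p

        indicator≡1 : ∀ {P : Set} (P? : Dec P) → P → indicator P? ≡ 1
        indicator≡1 (yes _) _ = refl
        indicator≡1 (no ¬p) p = contradiction p ¬p

        Free : Fin k → Set
        Free j = 0 < Matroid.rank (N j) ⁅ e ⁆ × (∀ l → ¬ Occupied l j)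

        free? : ∀ j → Dec (Free j)
        free? j = (0 <? Matroid.rank (N j) ⁅ e ⁆) ×-dec Fin.all? (λ l → ¬? (occupied? l j))

        indicator≤ : ∀ l j → indicator (occupied? l j) ≤ Matroid.rank (U l) ⁅ e ⁆
        indicator≤ l j with occupied? l j
        ... | yes (e∈X , _) = 0<rank-U e∈X
        ... | no _          = z≤n

        occupied≤ : ∀ l → Σ[ (λ j → indicator (occupied? l j)) ] ≤ Matroid.rank (U l) ⁅ e ⁆
        occupied≤ l = Σ-at-most-one _ (indicator≤ l) λ {i} {j} 0<i 0<j →
          let _ , t< , ci = 0<indicator⇒ (occupied? l i) 0<i
              _ , _  , cj = 0<indicator⇒ (occupied? l j) 0<j
          in color-unique t< ci cj

        rank≤occupied : (∀ j → ¬ Free j) → ∀ j → Matroid.rank (N j) ⁅ e ⁆ ≤ Σ[ (λ l → indicator (occupied? l j)) ]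
        rank≤occupied none j with Fin.any? (λ l → occupied? l j)
        ... | yes (l , occ) = ≤-trans (rank-⁅⁆≤1 (N j) e) (≤-trans
          (≤-reflexive (sym (indicator≡1 (occupied? l j) occ))) (term≤Σ (λ l → indicator (occupied? l j)) l))
        ... | no  unocc = ≤-trans (≮⇒≥ λ 0<r → none j (0<r , λ l occ → unocc (l , occ))) z≤n

        -- The w(e) matroids N j in which e is not a loop are not exhausted by the
        -- w(e) − 1 other hyperedges through e.
        free-exists : ∀ {i} → X i ≡ ⁅ e ⁆ → ∃ Free
        free-exists {i} X≡e with Fin.any? free?
        ... | yes free = free
        ... | no  none = contradiction (begin
          1                                                 ≤⟨ 0<rank-U (subst (e ∈_) (sym X≡e) (x∈⁅x⁆ e)) ⟩
          -- If no N j were free, every N j with non-loop e would be occupied, and the bounds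
          -- `occupied≤` would be tight for every hyperedge. For i itself this fails, because X i
          -- has at most `t i` points and occupies nothing.
          Matroid.rank (U i) ⁅ e ⁆                          ≤⟨ Σ-squeeze occupied≤ bound i ⟩
          Σ[ (λ j → indicator (occupied? i j)) ]            ≡⟨ Σ-zero (λ j → n≤0⇒n≡0 (≮⇒≥ λ 0<i →
            <⇒≱ (proj₁ (proj₂ (0<indicator⇒ (occupied? i j) 0<i))) (∣singleton∣≤t X≡e))) ⟩
          0                                                 ∎) λ ()
          where
          open ≤-Reasoning
          bound : Σ[ (λ l → Matroid.rank (U l) ⁅ e ⁆) ] ≤ Σ[ (λ l → Σ[ (λ j → indicator (occupied? l j)) ]) ]
          bound = begin
            Σ[ (λ l → Matroid.rank (U l) ⁅ e ⁆) ]                  ≡⟨ decomposes ⁅ e ⁆ ⟩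
            Σ[ (λ j → Matroid.rank (N j) ⁅ e ⁆) ]                  ≤⟨ Σ-mono-≤ (rank≤occupied λ j free → none (j , free)) ⟩
            Σ[ (λ j → Σ[ (λ l → indicator (occupied? l j)) ]) ]    ≡⟨ Σ-comm (λ l j → indicator (occupied? l j)) ⟨
            Σ[ (λ l → Σ[ (λ j → indicator (occupied? l j)) ]) ]    ∎

      opaque
        admissible : ∀ i → ∃ (Admissible i)
        admissible i with large⊎singleton i
        ... | inj₁ t< = let j , col = color-exists t< in j , record
          { nonloop = color-nonloop t< col
          ; rank≤t  = color-rank col
          ; large   = λ _ → col
          ; fresh   = λ X≡e → contradiction t< (≤⇒≯ (∣singleton∣≤t X≡e))
          }
        ... | inj₂ (e , X≡e) = let j , 0<r , unocc = free-exists e X≡e in j , record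
          { nonloop = λ x∈X → subst (λ x → 0 < Matroid.rank (N j) ⁅ x ⁆) (sym (x∈⁅y⁆⇒x≡y e (subst (_ ∈_) X≡e x∈X))) 0<r
          ; rank≤t  = λ {S} S⊆X → ≤-trans (Matroid.bounded (N j) S) (≤-trans (p⊆q⇒∣p∣≤∣q∣ S⊆X) (∣singleton∣≤t X≡e))
          ; large   = λ t< → contradiction t< (≤⇒≯ (∣singleton∣≤t X≡e))
          ; fresh   = λ {e′} X≡e′ {l} t< e′∈l col → unocc l (subst (_∈ X l) (x∈⁅y⁆⇒x≡y e (subst (e′ ∈_)
                        (trans (sym X≡e′) X≡e) (x∈⁅x⁆ e′))) e′∈l , t< , col)
          }

      coloring : Fin n → Fin k
      coloring i = proj₁ (admissible i)

      open module Admitted {i} = Admissible (proj₂ (admissible i))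

      coloring-separating : Separating coloring
      coloring-separating {i} {l} i≢l x∈i x∈l ci≡cl with large⊎singleton i | large⊎singleton l
      ... | inj₁ t<i | inj₁ t<l = color-proper noTriangle i≢l t<i t<l (large t<i)
                                    (subst (Color l) (sym ci≡cl) (large t<l)) x∈i x∈l
      ... | inj₂ (_ , X≡e) | inj₂ (_ , X≡e′) = i≢l (same-point X≡e X≡e′ x∈i x∈l)
      ... | inj₁ t<i | inj₂ (e , X≡e) = fresh X≡e t<i
        (subst (_∈ X i) (x∈⁅y⁆⇒x≡y e (subst (_ ∈_) X≡e x∈l)) x∈i) (subst (Color i) ci≡cl (large t<i))
      ... | inj₂ (e , X≡e) | inj₁ t<l = fresh X≡e t<l
        (subst (_∈ X l) (x∈⁅y⁆⇒x≡y e (subst (_ ∈_) X≡e x∈i)) x∈l) (subst (Color l) (sym ci≡cl) (large t<l))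

      -- Comparison of N with the color classes.

      private
        M : Fin k → Matroid m
        M = colorClass coloring coloring-separating

        ΣM≡ΣN : ∀ A → Σ[ (λ j → Matroid.rank (M j) A) ] ≡ Σ[ (λ j → Matroid.rank (N j) A) ]
        ΣM≡ΣN A = trans (sym (Σ-colorClass coloring coloring-separating A)) (decomposes A)

      M-point≤ : ∀ x j → Matroid.rank (M j) ⁅ x ⁆ ≤ Matroid.rank (N j) ⁅ x ⁆
      M-point≤ x j with 0 <? Matroid.rank (M j) ⁅ x ⁆
      ... | no  r≯0 = ≤-trans (≮⇒≥ r≯0) z≤n
      ... | yes 0<r = let i , ci≡j , x∈X = colorClass-point coloring coloring-separating 0<r in
        ≤-trans (rank-⁅⁆≤1 (M j) x) (subst (λ j → 0 < Matroid.rank (N j) ⁅ x ⁆) ci≡j (nonloop x∈X))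

      -- Every non-loop of M j is one of N j, and at each point the ranks have the same sum over j.
      -- Hence N j has no non-loops beyond those of M j.
      nonloop-covered : ∀ {x j} → 0 < Matroid.rank (N j) ⁅ x ⁆ → ∃ λ i → coloring i ≡ j × x ∈ X i
      nonloop-covered {x} {j} 0<r = colorClass-point coloring coloring-separating
        (≤-trans 0<r (Σ-squeeze (M-point≤ x) (≤-reflexive (sym (ΣM≡ΣN ⁅ x ⁆))) j))

      restrict : ∀ {P : Set} → Dec P → Subset m → Subset m
      restrict (yes _) S = S
      restrict (no  _) S = ∅

      ∈-restrict : ∀ {P : Set} (P? : Dec P) {S : Subset m} {x} → P → x ∈ S → x ∈ restrict P? S
      ∈-restrict (yes _) _ x∈S = x∈S
      ∈-restrict (no ¬p) p _   = contradiction p ¬p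

      rank-restrict≤ : ∀ j i A → Matroid.rank (N j) (restrict (coloring i Fin.≟ j) (A ∩ X i)) ≤
                                 Matroid.rank (component coloring coloring-separating j i) A
      rank-restrict≤ j i A with coloring i Fin.≟ j
      ... | no _      = ≤-reflexive (Matroid.normalized (N j))
      ... | yes refl  = ⊓-glb (Matroid.bounded (N j) (A ∩ X i)) (rank≤t (p∩q⊆q A (X i)))

      rank-N≤M : ∀ A j → Matroid.rank (N j) A ≤ Matroid.rank (M j) A
      rank-N≤M A j = ≤-trans
        (rank-cover (N j) (λ i → restrict (coloring i Fin.≟ j) (A ∩ X i)) A λ x∈A 0<r →
          let i , ci≡j , x∈X = nonloop-covered 0<r in
          i , ∈-restrict (coloring i Fin.≟ j) ci≡j (x∈p∩q⁺ (x∈A , x∈X)))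
        (Σ-mono-≤ λ i → rank-restrict≤ j i A)

      colorClass-coloring : ∀ j A → Matroid.rank (M j) A ≡ Matroid.rank (N j) A
      colorClass-coloring j A =
        ≤-antisym (Σ-squeeze (rank-N≤M A) (≤-reflexive (ΣM≡ΣN A)) j) (rank-N≤M A j)

-- Colorings and decompositions.

lookup-injective : ∀ {A : Set} {xs : List A} → Unique xs → ∀ {i j} → lookup xs i ≡ lookup xs j → i ≡ j
lookup-injective {xs = _ List.∷ _}  (_  AllPairs.∷ _)  {zero}  {zero}  _  = refl
lookup-injective {xs = _ List.∷ xs} (x∉ AllPairs.∷ _)  {zero}  {suc j} eq = contradiction eq (All.lookup x∉ (∈-lookup {xs = xs} j))
lookup-injective {xs = _ List.∷ xs} (x∉ AllPairs.∷ _)  {suc i} {zero}  eq = contradiction (sym eq) (All.lookup x∉ (∈-lookup {xs = xs} i))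
lookup-injective {xs = _ List.∷ _}  (_  AllPairs.∷ un) {suc i} {suc j} eq = cong suc (lookup-injective un eq)

funToFin-cong : {f g : Fin m → Fin n} → (∀ i → f i ≡ g i) → funToFin f ≡ funToFin g
funToFin-cong {zero}  f≡g = refl
funToFin-cong {suc m} f≡g = cong₂ combine (f≡g zero) (funToFin-cong (f≡g ∘ suc))

finToFun-injective : {x y : Fin (n ^ m)} → (∀ i → finToFun {n} {m} x i ≡ finToFun y i) → x ≡ y
finToFun-injective {n} {m} {x} {y} eq = trans (sym (Fin.funToFin-finToFin {m} {n} x))
  (trans (funToFin-cong eq) (Fin.funToFin-finToFin {m} {n} y))

-- Positions in the filtered list are matched with colorings. The list has no repetitions and codes
-- determine maps, so distinct positions give distinct colorings.
chromaticPolynomial-counts : (G : Graph n) (k : ℕ) → HasCardinality (ProperColorings G k) (chromaticPolynomial G k)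
chromaticPolynomial-counts {n} G k = record
  { to        = λ x → finToFun (lookup codes x) , proj₂ (∈-filter⁻ isProper? {xs = allFin (k ^ n)} (∈-lookup {xs = codes} x))
  ; cong      = λ { refl _ → refl }
  ; bijective = (λ eq → lookup-injective (Unique.filter⁺ isProper? (Unique.allFin⁺ (k ^ n))) (finToFun-injective {k} {n} eq))
              , λ (c , p) → let c∈ = c∈codes c p in
                  Any.index c∈ , λ { refl i → trans (cong (λ x → finToFun x i) (sym (lookup-index c∈)))
                                                    (Fin.finToFun-funToFin c i) }
  }
  where
  isProper? : ∀ x → Dec (Proper G {k} (finToFun x))
  isProper? x = proper? G {k} (finToFun x)
  codes : List (Fin (k ^ n))
  codes = filter isProper? (allFin (k ^ n))
  c∈codes : ∀ c → Proper G c → funToFin c ∈ˡ codes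
  c∈codes c p = ∈-filter⁺ isProper? (∈-allFin (funToFin c)) λ i j adj eq → p i j adj
    (trans (sym (Fin.finToFun-funToFin c i)) (trans eq (Fin.finToFun-funToFin c j)))

-- Application to the hypergraph of the theorem.

module _ (H : Hypergraph m n) where
  open Hypergraph H

  0<w : ∀ {i e} → e ∈ X i → 0 < w e
  0<w {i} {e} e∈X = ∈-length (∈-filter⁺ (λ i → e ∈? X i) (∈-allFin i) e∈X)

  -- Every e in X i is counted at least once by `w e`, namely for i itself. This makes `t i`
  -- positive, as the formula for deficits in uniform matroids requires.
  0<min-w : ∀ i → 0 < min-w i
  0<min-w i = v≤min⁺ (0<w (proj₂ (X-nonempty i))) (All.map⁺ (All.map 0<w (All.all-filter (_∈? X i) (allFin m))))

  module _ (t : Fin n → ℕ)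
    (meet≤1 : ∀ i j → i ≢ j → ∣ X i ∩ X j ∣ ≤ 1)
    (noTriangle : NoTriangle)
    (t≡1⊎ : ∀ i → t i ≡ 1 ⊎ (min-w i ≤ t i × t i < ∣ X i ∣)) where

    0<t : ∀ i → 0 < t i
    0<t i = [ (λ t≡1 → ≤-reflexive (sym t≡1)) , (λ (min≤t , _) → ≤-trans (0<min-w i) min≤t) ]′ (t≡1⊎ i)

    linear : ∀ {i j x y} → i ≢ j → x ∈ X i → x ∈ X j → y ∈ X i → y ∈ X j → x ≡ y
    linear {i} {j} i≢j x∈i x∈j y∈i y∈j =
      ∣-∣≤1⇒≡ (meet≤1 i j i≢j) (x∈p∩q⁺ (x∈i , x∈j)) (x∈p∩q⁺ (y∈i , y∈j))

    large⊎singleton : ∀ i → t i < ∣ X i ∣ ⊎ ∃ λ e → X i ≡ ⁅ e ⁆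
    large⊎singleton i with t≡1⊎ i
    ... | inj₂ (_ , t<) = inj₁ t<
    ... | inj₁ t≡1 with t i <? ∣ X i ∣
    ...   | yes t< = inj₁ t<
    ...   | no t≮ with e , e∈X ← X-nonempty i = inj₂ (e , ⊆-antisym
      (λ x∈X → subst (_∈ ⁅ e ⁆) (∣-∣≤1⇒≡ (≤-trans (≮⇒≥ t≮) (≤-reflexive t≡1)) e∈X x∈X) (x∈⁅x⁆ e)) (⁅⁆⊆ e∈X))

    open Lines X t 0<t linear

    separating : ∀ {k} {c : Fin n → Fin k} → Proper lineGraph c → Separating c
    separating proper {i} {j} i≢j x∈i x∈j = proper i j (i≢j , _ , x∈p∩q⁺ (x∈i , x∈j))

    proper : ∀ {k} {c : Fin n → Fin k} → Separating c → Proper lineGraph c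
    proper sep i j (i≢j , x , x∈) = let x∈i , x∈j = x∈p∩q⁻ (X i) (X j) x∈ in sep i≢j x∈i x∈j

    decompose : ∀ {k} → Colorable lineGraph k → 𝒟 k (ρ H t)
    decompose (c , p) = colorClass c (separating p) , λ A → cong ℤ.+_ (Σ-colorClass c (separating p) A)

    noTriangle′ : ∀ {a b c i j l} → a ≢ b → a ≢ c → b ≢ c →
      X i ≡ ⁅ a ⁆ ∪ ⁅ b ⁆ → X j ≡ ⁅ a ⁆ ∪ ⁅ c ⁆ → X l ≢ ⁅ b ⁆ ∪ ⁅ c ⁆
    noTriangle′ a≢b a≢c b≢c ab ac bc = noTriangle _ _ _ a≢b a≢c b≢c ((_ , ab) , (_ , ac) , (_ , bc))

    recolor : ∀ {k} → 𝒟 k (ρ H t) → Colorable lineGraph k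
    recolor (N , eq) = coloring , proper coloring-separating
      where open Surjectivity large⊎singleton X-injective noTriangle′ N (λ A → +-injective (eq A))

    colorings⤖decompositions : ∀ k → Bijection (ProperColorings lineGraph k) (Δ (ρ H t) k)
    colorings⤖decompositions k = record
      { to        = decompose
      ; cong      = λ {(c , p)} {(c′ , p′)} → decompose-cong p p′
      ; bijective = (λ {(c , p)} {(c′ , p′)} same →
                      colorClass-injective large⊎singleton X-injective (separating p) (separating p′) same)
                  , λ (N , eq) → recolor (N , eq) , λ {(c , p)} c≡ j A → trans
                      (decompose-cong p (proj₂ (recolor (N , eq))) c≡ j A)
                      (Surjectivity.colorClass-coloring large⊎singleton X-injective noTriangle′ N (λ A → +-injective (eq A)) j A)
      }
      where
      -- The proof of separation enters a color class only through the field `bounded`, so the ranks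
      -- depend on nothing but the values of the coloring.
      decompose-cong : ∀ {c c′ : Fin n → Fin k} (p : Proper lineGraph c) (p′ : Proper lineGraph c′) → (∀ i → c i ≡ c′ i) → ∀ j A →
        Matroid.rank (colorClass c (separating p) j) A ≡ Matroid.rank (colorClass c′ (separating p′) j) A
      decompose-cong p p′ c≡c′ j A =
        Σ-cong λ i → cong (λ u → Matroid.rank (when (u Fin.≟ j) (U i)) A) (c≡c′ i)

theorem2p7 : (m n : ℕ) (H : Hypergraph m n) (t : Fin n → ℕ) →
    let open Hypergraph H in
    (∀ i → t i ≤ ∣ X i ∣) →
    (∀ i j → i ≢ j → ∣ X i ∩ X j ∣ ≤ 1) →
    NoTriangle →
    (∀ i → t i ≡ 1 ⊎ (min-w i ≤ t i × t i < ∣ X i ∣)) →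
    (∀ k → 0 < k → Bijection (ProperColorings lineGraph k) (Δ (ρ H t) k))
    × IsLeast (λ k → 𝒟 k (ρ H t)) (chromaticNumber lineGraph)
    × (∀ k → 0 < k → HasCardinality (Δ (ρ H t) k) (chromaticPolynomial lineGraph k))
theorem2p7 m n H t _ meet≤1 noTriangle t≡1⊎ =
    (λ k _ → bij k)
  , (decompose H t meet≤1 noTriangle t≡1⊎ (proj₁ χ-least) , λ j dec → proj₂ χ-least j (recolor H t meet≤1 noTriangle t≡1⊎ dec))
  , λ k _ → bijection (chromaticPolynomial-counts (Hypergraph.lineGraph H) k) (bij k)
  where
  bij = colorings⤖decompositions H t meet≤1 noTriangle t≡1⊎
  χ-least = proj₂ (leastColorable (Hypergraph.lineGraph H))
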